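{- Let $T$ be a tree on $n$ vertices with matching number $\beta$. Then $$H(T)\le \frac{1}{24}\left(6n^2-4\beta n+\beta^2+9\beta+10n-22\right),$$ with equality if and only if $T\cong A_{n,n-\beta}$.
   Context: The Harary index of a connected graph $G$ is $H(G)=\sum_{\{x,y\}\subseteq V(G),\,x\ne y}\frac{1}{d(x,y)}$, $d$ the shortest-path distance. The matching number of $G$ is the maximum number of pairwise vertex-disjoint edges. For $\frac{n-1}{2}\le m\le n-1$, the spur $A_{n,m}$ is the tree obtained from the star $S_{m+1}$ by adding a pendent edge to each of $n-m-1$ of its pendent vertices.
   Formalization: The formal statement assumes n ≥ 2: for the one-vertex tree (n = 1, β = 0) the claimed bound is −1/4 < 0 = H(T), so the inequality fails, and the spur A_{1,1} is undefined. -}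

module Defs where

open import Data.Bool using (Bool; true; false; _∧_; _∨_; if_then_else_; not)
open import Data.Nat using (ℕ; zero; suc; _+_; _*_; _∸_; _≤_; _≤ᵇ_; _<ᵇ_; _≡ᵇ_)
open import Data.Fin using (Fin; toℕ)
open import Data.List using (List; []; _∷_; _++_; [_]; length; map; foldr; allFin; concatMap)
open import Data.Bool.ListAction using (any)
open import Data.List.Relation.Unary.Linked using (Linked)
open import Data.List.Relation.Unary.Unique.Propositional using (Unique)
open import Data.List.Relation.Unary.All using (All)
open import Data.Product using (Σ; ∃; _×_; _,_)
open import Data.Integer as ℤ using (ℤ; +_)
open import Data.Rational as ℚ using (ℚ; 0ℚ)
open import Relation.Binary.PropositionalEquality using (_≡_)
open import Relation.Nullary using (¬_)
open import Function.Definitions using (Bijective)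

Graph : ℕ → Set
Graph n = Fin n → Fin n → Bool

_==_ : ∀ {n} → Fin n → Fin n → Bool
x == y = toℕ x ≡ᵇ toℕ y

IsSimple : ∀ {n} → Graph n → Set
IsSimple {n} G = (∀ x y → G x y ≡ G y x) × (∀ x → G x x ≡ false)

Adj : ∀ {n} → Graph n → Fin n → Fin n → Set
Adj G x y = G x y ≡ true

reach : ∀ {n} → Graph n → ℕ → Fin n → Fin n → Bool
reach G zero    x y = x == y
reach {n} G (suc k) x y = reach G k x y ∨ any (λ z → G x z ∧ reach G k z y) (allFin n)

Connected : ∀ {n} → Graph n → Set
Connected G = ∀ x y → ∃ λ k → reach G k x y ≡ true

HasCycle : ∀ {n} → Graph n → Set
HasCycle {n} G = Σ (Fin n) λ v → Σ (List (Fin n)) λ vs →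
  Unique (v ∷ vs) × (2 ≤ length vs) × Linked (Adj G) (v ∷ vs ++ [ v ])

IsTree : ∀ {n} → Graph n → Set
IsTree G = IsSimple G × Connected G × ¬ HasCycle G

-- least k ≤ b with p k = true (b if none)
least : (ℕ → Bool) → ℕ → ℕ
least p zero    = zero
least p (suc b) = if p zero then zero else suc (least (λ k → p (suc k)) b)

-- shortest-path distance (for connected graphs on n vertices, it is < n)
dist : ∀ {n} → Graph n → Fin n → Fin n → ℕ
dist {n} G x y = least (λ k → reach G k x y) n

inv : ℕ → ℚ
inv zero    = 0ℚ
inv (suc k) = (+ 1) ℚ./ suc k

sumℚ : List ℚ → ℚ
sumℚ = foldr ℚ._+_ 0ℚ

harary : ∀ {n} → Graph n → ℚ
harary {n} G = sumℚ (map (λ x → sumℚ (map (λ y →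
  if toℕ x <ᵇ toℕ y then inv (dist G x y) else 0ℚ) (allFin n))) (allFin n))

IsMatching : ∀ {n} → Graph n → List (Fin n × Fin n) → Set
IsMatching G M = All (λ { (a , b) → Adj G a b }) M
               × Unique (concatMap (λ { (a , b) → a ∷ b ∷ [] }) M)

IsMatchingNumber : ∀ {n} → Graph n → ℕ → Set
IsMatchingNumber G β = (∃ λ M → IsMatching G M × length M ≡ β)
                     × (∀ M → IsMatching G M → length M ≤ β)

-- spur A_{n,m}: centre 0 adjacent to 1..m; vertex m+i adjacent to i for 1 ≤ i ≤ n-m-1
spurArc : ℕ → ℕ → ℕ → Bool
spurArc m i j = ((i ≡ᵇ 0) ∧ (1 ≤ᵇ j) ∧ (j ≤ᵇ m)) ∨ ((1 ≤ᵇ i) ∧ (j ≡ᵇ i + m))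

spur : (n m : ℕ) → Graph n
spur n m x y = spurArc m (toℕ x) (toℕ y) ∨ spurArc m (toℕ y) (toℕ x)

_≅_ : ∀ {n} → Graph n → Graph n → Set
_≅_ {n} G H = Σ (Fin n → Fin n) λ f → Bijective _≡_ _≡_ f × (∀ x y → G x y ≡ H (f x) (f y))

bound : ℕ → ℕ → ℚ
bound n β = (+ (6 * n * n + β * β + 9 * β + 10 * n) ℤ.- + (4 * β * n + 22)) ℚ./ 24

{-# OPTIONS --safe #-}

-- Cut V(T) into pieces: the β edges of a maximum matching and the u = n − 2β unmatched vertices.
-- With 24/d as the weight of a pair at distance d, T bipartite and without cycles of length 4 or 6,
-- two matching edges contribute at most 34 (56 if adjacent), an edge and a vertex at most 20 (36 if
-- adjacent), and two unmatched vertices, never adjacent, at most 12.  Contracting the matching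
-- leaves a tree with n − β − 1 edges, at most β − 1 of which join two matching edges; adding up
-- gives exactly the bound.  In the equality case any two pieces are adjacent or have a common
-- neighbour, and a Helly argument (take the parent of the piece whose top is deepest) yields a
-- vertex adjacent to every other piece, so that T is the spur.
-- Block sums f(x,y) + f(x',y) + f(x,y') + f(x',y'), with ' the matching involution, replace sums
-- over pairs of pieces, so that only sums over vertices occur.

module Submission where

open import Defs
open import Data.Bool using (Bool; true; false; if_then_else_; not; _∧_; _∨_; T)
import Data.Bool.Properties as Boolₚ
open import Data.Empty using (⊥; ⊥-elim)
open import Data.Fin using (Fin; zero; suc; toℕ; fromℕ<; punchOut; _≟_)
import Data.Fin.Permutation as Perm
import Data.Fin.Properties as Finₚ
open import Data.Integer as ℤ using () renaming (+_ to pos)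
import Data.Integer.Properties as ℤₚ
open import Data.List using (List; []; _∷_; _++_; [_]; length; map; allFin; tabulate; concatMap)
open import Data.List.Membership.Propositional using (lose)
open import Data.List.Membership.Propositional.Properties using (∈-allFin)
open import Data.List.Properties using (map-tabulate)
open import Data.List.Relation.Unary.All as All using (All; []; _∷_)
import Data.List.Relation.Unary.All.Properties as Allₚ
open import Data.List.Relation.Unary.AllPairs using ([]; _∷_)
import Data.List.Relation.Unary.AllPairs.Properties as AllPairsₚ
import Data.List.Relation.Unary.Any as Any
import Data.List.Relation.Unary.Any.Properties as Anyₚ
open import Data.List.Relation.Unary.Linked using (Linked; [-]; _∷_)
open import Data.List.Relation.Unary.Unique.Propositional using (Unique)
open import Data.Nat using (ℕ; zero; suc; _+_; _*_; _∸_; _≤_; _<_; _<ᵇ_; _≤ᵇ_; _≡ᵇ_; z≤n; s≤s)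
open import Data.Nat.Properties hiding (_≟_)
open import Data.Nat.Tactic.RingSolver using (solve-∀)
open import Data.Product using (_×_; _,_; proj₁; proj₂; ∃)
open import Data.Rational as ℚ using (ℚ; 0ℚ)
import Data.Rational.Properties as ℚₚ
open import Data.Rational.Unnormalised as ℚᵘ using (mkℚᵘ; *≡*; *≤*)
import Data.Rational.Unnormalised.Properties as ℚᵘₚ
open import Data.Sum using (_⊎_; inj₁; inj₂; [_,_]′) renaming (map to map-⊎)
open import Function using (_∘_; id)
open import Function.Bundles using (_⇔_; mk⇔; Equivalence)
open import Function.Definitions using (Injective; Surjective; Bijective)
open import Relation.Binary.Definitions using (tri<; tri≈; tri>)
open import Relation.Binary.PropositionalEquality hiding ([_])
open import Relation.Nullary using (¬_; Dec; yes; no; does; contradiction)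
open import Relation.Nullary.Decidable using (_×-dec_; ¬?)

open import Algebra.Properties.Semiring.Sum +-*-semiring using (sum; sum-cong-≗; ∑-distrib-+; ∑-comm; sum-permute; *-distribˡ-sum; *-distribʳ-sum)

-- No distance is ever computed. A distance beyond 4 is treated as 3 or 4 according to its parity,
-- which costs nothing in the extremal case because the spur has diameter at most 4. In the tree,
-- parity and forbidden short cycles bound distances from below; in the spur, walks through the hub
-- bound them from above, and the general upper bound then gives equality. Treating edges and single
-- vertices as separate kinds of pieces would require three sums over subsets. Instead the indicator
-- of being matched enters as a polynomial variable, so that one inequality holds for all ordered
-- pairs of vertices and is summed once. It must also cover the pairs inside a single piece, and be
-- sharp there, since otherwise the totals would miss the bound. The count of β - 1 comes from
-- rooting the tree at a matched vertex. Every unmatched vertex is then the lower end of exactly one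
-- edge, and the only quantity not determined by n and β is the number of vertices whose parent is
-- matched. It is at most n, and this is the second place, besides the pairs of pieces, where slack
-- can occur.

private variable n : ℕ

-- Finite sums and rationals with denominator 24

bit : Bool → ℕ
bit b = if b then 1 else 0

sum-const : ∀ n c → sum {n} (λ _ → c) ≡ n * c
sum-const zero    c = refl
sum-const (suc n) c = cong (c +_) (sum-const n c)

sum-mono : {f g : Fin n → ℕ} → (∀ i → f i ≤ g i) → sum f ≤ sum g
sum-mono {zero}  f≤g = z≤n
sum-mono {suc n} f≤g = +-mono-≤ (f≤g zero) (sum-mono (f≤g ∘ suc))

f≤sum : (f : Fin n → ℕ) → ∀ i → f i ≤ sum f
f≤sum {suc n} f zero    = m≤m+n _ _
f≤sum {suc n} f (suc i) = ≤-trans (f≤sum (f ∘ suc) i) (m≤n+m _ _)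

-- The equality case is read off termwise from a single inequality between totals by means of this
-- lemma and `∑∑-tight`.
sum-tight : {f g : Fin n → ℕ} → (∀ i → f i ≤ g i) → sum g ≤ sum f → ∀ i → f i ≡ g i
sum-tight {suc n} {f} {g} f≤g Σ≥ zero = ≤-antisym (f≤g zero)
  (+-cancelʳ-≤ (sum (f ∘ suc)) _ _ (≤-trans (+-monoʳ-≤ (g zero) (sum-mono (f≤g ∘ suc))) Σ≥))
sum-tight {suc n} {f} {g} f≤g Σ≥ (suc i) = sum-tight (f≤g ∘ suc)
  (+-cancelˡ-≤ (f zero) _ _ (≤-trans (+-monoˡ-≤ (sum (g ∘ suc)) (f≤g zero)) Σ≥)) i

δ : Fin n → Fin n → ℕ
δ zero    zero    = 1
δ zero    (suc _) = 0
δ (suc _) zero    = 0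
δ (suc i) (suc j) = δ i j

δ-refl : (i : Fin n) → δ i i ≡ 1
δ-refl zero    = refl
δ-refl (suc i) = δ-refl i

δ-≢ : {i j : Fin n} → i ≢ j → δ i j ≡ 0
δ-≢ {i = zero}  {zero}  i≢j = contradiction refl i≢j
δ-≢ {i = zero}  {suc j} i≢j = refl
δ-≢ {i = suc i} {zero}  i≢j = refl
δ-≢ {i = suc i} {suc j} i≢j = δ-≢ (i≢j ∘ cong suc)

sum-δ : (i : Fin n) (f : Fin n → ℕ) → sum (λ j → δ i j * f j) ≡ f i
sum-δ {suc n} zero    f = trans (cong₂ _+_ (+-identityʳ (f zero)) (trans (sum-const n 0) (*-zeroʳ n))) (+-identityʳ _)
sum-δ {suc n} (suc i) f = sum-δ i (f ∘ suc)

sum-δ₁ : (i : Fin n) → sum (δ i) ≡ 1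
sum-δ₁ i = trans (sum-cong-≗ λ j → sym (*-identityʳ (δ i j))) (sum-δ i (λ _ → 1))

sum-involution : (f : Fin n → ℕ) (σ : Fin n → Fin n) → (∀ i → σ (σ i) ≡ i) → sum (f ∘ σ) ≡ sum f
sum-involution f σ σσ = sym (sum-permute f (Perm.permutation σ σ σσ σσ))

∑∑ : (Fin n → Fin n → ℕ) → ℕ
∑∑ f = sum λ x → sum λ y → f x y

∑∑-cong : {f g : Fin n → Fin n → ℕ} → (∀ x y → f x y ≡ g x y) → ∑∑ f ≡ ∑∑ g
∑∑-cong f≡g = sum-cong-≗ λ x → sum-cong-≗ λ y → f≡g x y

∑∑-mono : {f g : Fin n → Fin n → ℕ} → (∀ x y → f x y ≤ g x y) → ∑∑ f ≤ ∑∑ g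
∑∑-mono f≤g = sum-mono λ x → sum-mono λ y → f≤g x y

∑∑-tight : {f g : Fin n → Fin n → ℕ} → (∀ x y → f x y ≤ g x y) → ∑∑ g ≤ ∑∑ f → ∀ x y → f x y ≡ g x y
∑∑-tight f≤g Σ≥ x = sum-tight (f≤g x) (≤-reflexive (sym (sum-tight (λ x → sum-mono (f≤g x)) Σ≥ x)))

∑∑-+ : (f g : Fin n → Fin n → ℕ) → ∑∑ (λ x y → f x y + g x y) ≡ ∑∑ f + ∑∑ g
∑∑-+ f g = trans (sum-cong-≗ λ x → ∑-distrib-+ (f x) (g x)) (∑-distrib-+ (sum ∘ f) (sum ∘ g))

∑∑-*ˡ : ∀ c (f : Fin n → Fin n → ℕ) → ∑∑ (λ x y → c * f x y) ≡ c * ∑∑ f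
∑∑-*ˡ c f = trans (sum-cong-≗ λ x → sym (*-distribˡ-sum c (f x))) (sym (*-distribˡ-sum c (sum ∘ f)))

∑∑-× : (f g : Fin n → ℕ) → ∑∑ (λ x y → f x * g y) ≡ sum f * sum g
∑∑-× f g = trans (sum-cong-≗ λ x → sym (*-distribˡ-sum (f x) g)) (sym (*-distribʳ-sum (sum g) f))

∑∑-const : ∀ c → ∑∑ {n} (λ x y → c) ≡ n * (n * c)
∑∑-const {n} c = trans (sum-cong-≗ {n} λ x → sum-const n c) (sum-const n (n * c))

∑∑-fst : (f : Fin n → ℕ) → ∑∑ (λ x y → f x) ≡ n * sum f
∑∑-fst {n} f = trans (sum-cong-≗ λ x → sum-const n (f x)) (sym (*-distribˡ-sum n f))

∑∑-snd : (f : Fin n → ℕ) → ∑∑ (λ x y → f y) ≡ n * sum f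
∑∑-snd {n} f = sum-const n (sum f)

∑∑-flip : (f : Fin n → Fin n → ℕ) → ∑∑ (λ x y → f y x) ≡ ∑∑ f
∑∑-flip f = sym (∑-comm f)

-- Unordered pairs are selected exactly as in `harary`, so that the two sums can be compared entry
-- by entry.
∑< : (Fin n → Fin n → ℕ) → ℕ
∑< f = ∑∑ λ x y → if toℕ x <ᵇ toℕ y then f x y else 0

module _ (f : Fin n → Fin n → ℕ) (f-sym : ∀ x y → f x y ≡ f y x) (f-diag : ∀ x → f x x ≡ 0) where

  private
    split : ∀ x y → (if toℕ x <ᵇ toℕ y then f x y else 0) + (if toℕ y <ᵇ toℕ x then f y x else 0) ≡ f x y
    split x y with toℕ x <ᵇ toℕ y in p | toℕ y <ᵇ toℕ x in q
    ... | true  | true  = contradiction (<ᵇ⇒< (toℕ y) (toℕ x) (subst T (sym q) _))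
                            (<-asym (<ᵇ⇒< (toℕ x) (toℕ y) (subst T (sym p) _)))
    ... | true  | false = +-identityʳ _
    ... | false | true  = f-sym y x
    ... | false | false = sym (trans (cong (f x) (sym x≡y)) (f-diag x))
      where
      x≡y : x ≡ y
      x≡y = Finₚ.toℕ-injective (≤-antisym
        (≮⇒≥ λ y<x → subst T q (<⇒<ᵇ y<x)) (≮⇒≥ λ x<y → subst T p (<⇒<ᵇ x<y)))

  ∑∑≡2∑< : ∑∑ f ≡ 2 * ∑< f
  ∑∑≡2∑< = begin
    ∑∑ f                               ≡⟨ ∑∑-cong (λ x y → sym (split x y)) ⟩
    ∑∑ (λ x y → h x y + h y x)         ≡⟨ ∑∑-+ h (λ x y → h y x) ⟩
    ∑∑ h + ∑∑ (λ x y → h y x)          ≡⟨ cong (∑∑ h +_) (trans (∑∑-flip h) (sym (+-identityʳ (∑∑ h)))) ⟩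
    2 * ∑∑ h                           ∎
    where
    open ≡-Reasoning
    h : Fin n → Fin n → ℕ
    h x y = if toℕ x <ᵇ toℕ y then f x y else 0

_/24 : ℕ → ℚ
w /24 = pos w ℚ./ 24

private
  toℚᵘ-/ : ∀ w d → ℚ.toℚᵘ (pos w ℚ./ suc d) ℚᵘ.≃ mkℚᵘ (pos w) d
  toℚᵘ-/ w d = ℚₚ.toℚᵘ-fromℚᵘ (mkℚᵘ (pos w) d)

/-mono : ∀ a b c d → a * suc d ≤ c * suc b → pos a ℚ./ suc b ℚ.≤ pos c ℚ./ suc d
/-mono a b c d le = ℚₚ.toℚᵘ-cancel-≤ (ℚᵘₚ.≤-respˡ-≃ (ℚᵘₚ.≃-sym (toℚᵘ-/ a b))
  (ℚᵘₚ.≤-respʳ-≃ (ℚᵘₚ.≃-sym (toℚᵘ-/ c d))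
  (*≤* (subst₂ ℤ._≤_ (ℤₚ.pos-* a (suc d)) (ℤₚ.pos-* c (suc b)) (ℤ.+≤+ le)))))

/24-cancel : ∀ {a b} → a /24 ℚ.≤ b /24 → a ≤ b
/24-cancel {a} {b} le with ℚᵘₚ.≤-respˡ-≃ (toℚᵘ-/ a 23) (ℚᵘₚ.≤-respʳ-≃ (toℚᵘ-/ b 23) (ℚₚ.toℚᵘ-mono-≤ le))
... | *≤* le' = *-cancelʳ-≤ a b 24 (ℤₚ.drop‿+≤+ (subst₂ ℤ._≤_ (sym (ℤₚ.pos-* a 24)) (sym (ℤₚ.pos-* b 24)) le'))

/24-mono : ∀ {a b} → a ≤ b → a /24 ℚ.≤ b /24
/24-mono {a} {b} le = /-mono a 23 b 23 (*-monoˡ-≤ 24 le)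

/24-+ : ∀ a b → a /24 ℚ.+ b /24 ≡ (a + b) /24
/24-+ a b = ℚₚ.toℚᵘ-injective (ℚᵘₚ.≃-trans (ℚₚ.toℚᵘ-homo-+ (a /24) (b /24))
  (ℚᵘₚ.≃-trans (ℚᵘₚ.+-cong (toℚᵘ-/ a 23) (toℚᵘ-/ b 23))
  (ℚᵘₚ.≃-trans (*≡* eq) (ℚᵘₚ.≃-sym (toℚᵘ-/ (a + b) 23)))))
  where
  eq : (pos a ℤ.* pos 24 ℤ.+ pos b ℤ.* pos 24) ℤ.* pos 24 ≡ pos (a + b) ℤ.* pos 576
  eq = begin
    (pos a ℤ.* pos 24 ℤ.+ pos b ℤ.* pos 24) ℤ.* pos 24 ≡⟨ cong (ℤ._* pos 24) (sym (ℤₚ.*-distribʳ-+ (pos 24) (pos a) (pos b))) ⟩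
    pos (a + b) ℤ.* pos 24 ℤ.* pos 24              ≡⟨ ℤₚ.*-assoc (pos (a + b)) (pos 24) (pos 24) ⟩
    pos (a + b) ℤ.* pos 576                      ∎
    where open ≡-Reasoning

sumℚ-≤ : {h : Fin n → ℚ} {w : Fin n → ℕ} → (∀ i → h i ℚ.≤ w i /24) → sumℚ (map h (allFin n)) ℚ.≤ sum w /24
sumℚ-≤ {n} {h} {w} h≤w rewrite map-tabulate {n = n} id h = go h w h≤w
  where
  go : ∀ {n} (h : Fin n → ℚ) (w : Fin n → ℕ) → (∀ i → h i ℚ.≤ w i /24) → sumℚ (tabulate h) ℚ.≤ sum w /24
  go {zero}  h w h≤w = ℚₚ.≤-refl
  go {suc n} h w h≤w = ℚₚ.≤-trans (ℚₚ.+-mono-≤ (h≤w zero) (go (h ∘ suc) (w ∘ suc) (h≤w ∘ suc)))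
    (ℚₚ.≤-reflexive (/24-+ (w zero) (sum (w ∘ suc))))

sumℚ-≥ : {h : Fin n → ℚ} {w : Fin n → ℕ} → (∀ i → w i /24 ℚ.≤ h i) → sum w /24 ℚ.≤ sumℚ (map h (allFin n))
sumℚ-≥ {n} {h} {w} w≤h rewrite map-tabulate {n = n} id h = go h w w≤h
  where
  go : ∀ {n} (h : Fin n → ℚ) (w : Fin n → ℕ) → (∀ i → w i /24 ℚ.≤ h i) → sum w /24 ℚ.≤ sumℚ (tabulate h)
  go {zero}  h w w≤h = ℚₚ.≤-refl
  go {suc n} h w w≤h = ℚₚ.≤-trans (ℚₚ.≤-reflexive (sym (/24-+ (w zero) (sum (w ∘ suc)))))
    (ℚₚ.+-mono-≤ (w≤h zero) (go (h ∘ suc) (w ∘ suc) (w≤h ∘ suc)))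

module _ (G : Graph n) (w : Fin n → Fin n → ℕ) where

  harary-≤ : (∀ x y → inv (dist G x y) ℚ.≤ w x y /24) → harary G ℚ.≤ ∑< w /24
  harary-≤ le = sumℚ-≤ {n} λ x → sumℚ-≤ {n} λ y → pt x y
    where
    pt : ∀ x y → (if toℕ x <ᵇ toℕ y then inv (dist G x y) else 0ℚ) ℚ.≤ (if toℕ x <ᵇ toℕ y then w x y else 0) /24
    pt x y with toℕ x <ᵇ toℕ y
    ... | true  = le x y
    ... | false = ℚₚ.≤-refl

  harary-≥ : (∀ x y → w x y /24 ℚ.≤ inv (dist G x y)) → ∑< w /24 ℚ.≤ harary G
  harary-≥ le = sumℚ-≥ {n} λ x → sumℚ-≥ {n} λ y → pt x y
    where
    pt : ∀ x y → (if toℕ x <ᵇ toℕ y then w x y else 0) /24 ℚ.≤ (if toℕ x <ᵇ toℕ y then inv (dist G x y) else 0ℚ)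
    pt x y with toℕ x <ᵇ toℕ y
    ... | true  = le x y
    ... | false = ℚₚ.≤-refl

-- `bound` subtracts in the integers; a natural B that solves the equation lets all numerators be
-- compared in ℕ.
bound≡ : ∀ n β B → B + (4 * β * n + 22) ≡ 6 * n * n + β * β + 9 * β + 10 * n → bound n β ≡ B /24
bound≡ n β B eq = cong (ℚ._/ 24) (begin
  pos X ℤ.- pos Y               ≡⟨ cong (λ z → pos z ℤ.- pos Y) (sym eq) ⟩
  pos B ℤ.+ pos Y ℤ.- pos Y       ≡⟨ ℤₚ.+-assoc (pos B) (pos Y) (ℤ.- pos Y) ⟩
  pos B ℤ.+ (pos Y ℤ.- pos Y)     ≡⟨ cong (ℤ._+_ (pos B)) (ℤₚ.+-inverseʳ (pos Y)) ⟩
  pos B ℤ.+ pos 0               ≡⟨ ℤₚ.+-identityʳ (pos B) ⟩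
  pos B                       ∎)
  where
  open ≡-Reasoning
  X = 6 * n * n + β * β + 9 * β + 10 * n
  Y = 4 * β * n + 22

-- Walks, distance and rooted trees

true⇒T : ∀ {b} → b ≡ true → T b
true⇒T = Equivalence.from Boolₚ.T-≡

T⇒true : ∀ {b} → T b → b ≡ true
T⇒true = Equivalence.to Boolₚ.T-≡

-- Wrapping the Boolean equation keeps graph, length and ends recoverable from the type even where
-- `reach` computes.
record Reach (G : Graph n) (k : ℕ) (x y : Fin n) : Set where
  constructor reached
  field holds : reach G k x y ≡ true
open Reach

reach-refl : (G : Graph n) → ∀ x → Reach G 0 x x
reach-refl G x = reached (T⇒true (≡⇒≡ᵇ (toℕ x) (toℕ x) refl))

module _ {G : Graph n} where

  reach-zero⁻ : ∀ {x y} → Reach G 0 x y → x ≡ y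
  reach-zero⁻ {x} {y} R = Finₚ.toℕ-injective (≡ᵇ⇒≡ (toℕ x) (toℕ y) (true⇒T (holds R)))

  reach-step : ∀ {k x y z} → Adj G x z → Reach G k z y → Reach G (suc k) x y
  reach-step {k} {x} {y} {z} Gxz Rzy = reached (T⇒true (Equivalence.from (Boolₚ.T-∨ {reach G k x y})
    (inj₂ (Anyₚ.any⁺ _ (lose (∈-allFin z) (Equivalence.from Boolₚ.T-∧ (true⇒T Gxz , true⇒T (holds Rzy))))))))

  reach-suc⁻ : ∀ {k x y} → Reach G (suc k) x y → Reach G k x y ⊎ ∃ λ z → Adj G x z × Reach G k z y
  reach-suc⁻ {k} {x} {y} R with Equivalence.to (Boolₚ.T-∨ {reach G k x y}) (true⇒T (holds R))
  ... | inj₁ t = inj₁ (reached (T⇒true t))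
  ... | inj₂ t with Any.satisfied (Anyₚ.any⁻ _ (allFin n) t)
  ...   | z , tz with Equivalence.to (Boolₚ.T-∧ {G x z}) tz
  ...     | a , b = inj₂ (z , T⇒true a , reached (T⇒true b))

least-min : ∀ (p : ℕ → Bool) b {k} → p k ≡ true → least p b ≤ k
least-min p zero    pk = z≤n
least-min p (suc b) {k} pk with p 0 in p0
... | true  = z≤n
least-min p (suc b) {zero}  pk | false = contradiction (trans (sym p0) pk) λ ()
least-min p (suc b) {suc k} pk | false = s≤s (least-min (p ∘ suc) b pk)

-- The hypothesis `k ≤ b` excludes the case in which `least` merely falls back on its default b.
least-holds : ∀ (p : ℕ → Bool) b {k} → p k ≡ true → k ≤ b → p (least p b) ≡ true
least-holds p zero    {zero} pk z≤n = pk
least-holds p (suc b) {k} pk k≤b with p 0 in p0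
... | true  = p0
least-holds p (suc b) {zero}  pk k≤b       | false = contradiction (trans (sym p0) pk) λ ()
least-holds p (suc b) {suc k} pk (s≤s k≤b) | false = least-holds (p ∘ suc) b pk k≤b

module Distance (G : Graph n) (connected : Connected G) where

  private
    -- `dist` cuts its search off at n, whereas connectivity supplies a bound of its own. The search
    -- up to that bound serves to show that n suffices.
    e : Fin n → Fin n → ℕ
    e x y = least (λ k → reach G k x y) (proj₁ (connected x y))

    e-reach : ∀ x y → Reach G (e x y) x y
    e-reach x y = reached (least-holds (λ k → reach G k x y) (proj₁ (connected x y)) (proj₂ (connected x y)) ≤-refl)

    e-min : ∀ {k} x y → Reach G k x y → e x y ≤ k
    e-min x y R = least-min (λ k → reach G k x y) (proj₁ (connected x y)) (holds R)

    descend : ∀ {j} x y → e x y ≡ suc j → ∃ λ z → Adj G x z × e z y ≡ j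
    descend {j} x y eq with reach-suc⁻ (subst (λ k → Reach G k x y) eq (e-reach x y))
    ... | inj₁ R = contradiction (e-min x y R) (<⇒≱ (≤-reflexive (sym eq)))
    ... | inj₂ (z , a , R) = z , a , ≤-antisym (e-min z y R)
      (≤-pred (≤-trans (≤-reflexive (sym eq)) (e-min x y (reach-step a (e-reach z y)))))

    level : ∀ {k} x y → e x y ≡ k → ∀ j → j ≤ k → ∃ λ z → e z y ≡ j
    level {k} x y eq j j≤k with m≤n⇒m<n∨m≡n j≤k
    ... | inj₂ refl = x , eq
    level {suc k} x y eq j _ | inj₁ (s≤s j≤k) with descend x y eq
    ... | z , _ , eq' = level z y eq' j j≤k

    -- Pigeonhole: descending from x to y meets a vertex at each of the distances 0, ..., `e x y`
    -- from y, and these vertices differ.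
    e<n : ∀ x y → e x y < n
    e<n x y = Finₚ.injective⇒≤ {f = λ i → proj₁ (f i)} inj
      where
      f : (i : Fin (suc (e x y))) → ∃ λ z → e z y ≡ toℕ i
      f i = level x y refl (toℕ i) (≤-pred (Finₚ.toℕ<n i))
      inj : ∀ {i j} → proj₁ (f i) ≡ proj₁ (f j) → i ≡ j
      inj {i} {j} eq = Finₚ.toℕ-injective (trans (sym (proj₂ (f i))) (trans (cong (λ z → e z y) eq) (proj₂ (f j))))

  dist-reach : ∀ x y → Reach G (dist G x y) x y
  dist-reach x y = reached (least-holds (λ k → reach G k x y) n (holds (e-reach x y)) (<⇒≤ (e<n x y)))

  dist-min : ∀ {k} x y → Reach G k x y → dist G x y ≤ k
  dist-min x y R = least-min (λ k → reach G k x y) n (holds R)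

  dist≡0⇒≡ : ∀ x y → dist G x y ≡ 0 → x ≡ y
  dist≡0⇒≡ x y eq = reach-zero⁻ (subst (λ k → Reach G k x y) eq (dist-reach x y))

  dist-refl : ∀ x → dist G x x ≡ 0
  dist-refl x = n≤0⇒n≡0 (dist-min x x (reach-refl G x))

  dist-adj : ∀ {x z} y → Adj G x z → dist G x y ≤ suc (dist G z y)
  dist-adj {x} {z} y a = dist-min x y (reach-step a (dist-reach z y))

  dist-descend : ∀ {j} x y → dist G x y ≡ suc j → ∃ λ z → Adj G x z × dist G z y ≡ j
  dist-descend {j} x y eq with reach-suc⁻ (subst (λ k → Reach G k x y) eq (dist-reach x y))
  ... | inj₁ R = contradiction (dist-min x y R) (<⇒≱ (≤-reflexive (sym eq)))
  ... | inj₂ (z , a , R) = z , a , ≤-antisym (dist-min z y R)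
    (≤-pred (≤-trans (≤-reflexive (sym eq)) (dist-adj y a)))

linked-snoc : ∀ {A : Set} {R : A → A → Set} xs {y z} → Linked R (xs ++ [ y ]) → R y z → Linked R ((xs ++ [ y ]) ++ [ z ])
linked-snoc []           [-]       r = r ∷ [-]
linked-snoc (x ∷ [])     (s ∷ [-]) r = s ∷ r ∷ [-]
linked-snoc (x ∷ w ∷ xs) (s ∷ l)   r = s ∷ linked-snoc (w ∷ xs) l r

even : ℕ → Bool
even zero    = true
even (suc n) = not (even n)

module RootedTree (G : Graph n) (tree : IsTree G) (r : Fin n) where

  open Distance G (proj₁ (proj₂ tree))

  acyclic : ¬ HasCycle G
  acyclic = proj₂ (proj₂ tree)

  adj-sym : ∀ {x y} → Adj G x y → Adj G y x
  adj-sym {x} {y} a = trans (sym (proj₁ (proj₁ tree) x y)) a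

  adj⇒≢ : ∀ {x y} → Adj G x y → x ≢ y
  adj⇒≢ {x} a refl = contradiction (trans (sym a) (proj₂ (proj₁ tree) x)) λ ()

  depth : Fin n → ℕ
  depth x = dist G x r

  lower : ∀ x → x ≡ r ⊎ ∃ λ z → Adj G x z × depth x ≡ suc (depth z)
  lower x with depth x in eq
  ... | zero  = inj₁ (dist≡0⇒≡ x r eq)
  ... | suc j with dist-descend x r eq
  ...   | z , a , eq' = inj₂ (z , a , cong suc (sym eq'))

  -- The root is its own parent.
  par : Fin n → Fin n
  par x = [ (λ _ → x) , proj₁ ]′ (lower x)

  par-adj : ∀ {x} → x ≢ r → Adj G x (par x)
  par-adj {x} x≢r with lower x
  ... | inj₁ x≡r         = contradiction x≡r x≢r
  ... | inj₂ (z , a , _) = a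

  par-depth : ∀ {x} → x ≢ r → depth x ≡ suc (depth (par x))
  par-depth {x} x≢r with lower x
  ... | inj₁ x≡r         = contradiction x≡r x≢r
  ... | inj₂ (z , _ , d) = d

  par-root : par r ≡ r
  par-root with lower r
  ... | inj₁ _           = refl
  ... | inj₂ (z , a , d) = contradiction (trans (sym (dist-refl r)) d) λ ()

  par-≢ : ∀ {x} → x ≢ r → par x ≢ x
  par-≢ x≢r eq = adj⇒≢ (par-adj x≢r) (sym eq)

  private
    below : ∀ {k x} → depth x ≡ suc k → x ≢ r
    below d refl = contradiction (trans (sym (dist-refl r)) d) λ ()

    -- Following parents from both ends of the path, the two branches meet at the root at the latest.
    ascend : ∀ k x mid y → depth x ≡ k → depth y ≡ k → Unique (x ∷ mid ++ [ y ]) →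
      Linked (Adj G) (x ∷ mid ++ [ y ]) → All (λ z → k ≤ depth z) (x ∷ mid ++ [ y ]) → HasCycle G
    ascend zero x mid y dx dy (x∉ ∷ _) _ _ =
      contradiction (trans (dist≡0⇒≡ x r dx) (sym (dist≡0⇒≡ y r dy))) (All.head (Allₚ.++⁻ʳ mid x∉))
    ascend (suc k) x mid y dx dy u l d with par x ≟ par y
    -- The whole path lies deeper than the parents of its ends, so these parents are new vertices.
    -- If they coincide, they close the path to a cycle; otherwise they extend it at both ends.
    ... | yes px≡py = par x , L , (p∉ ∷ u) , s≤s (length≥1 mid) ,
        adj-sym (par-adj x≢r) ∷ subst (λ z → Linked (Adj G) (L ++ [ z ])) (sym px≡py) (linked-snoc (x ∷ mid) l (par-adj y≢r))
      where
      x≢r = below dx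
      y≢r = below dy
      L = x ∷ mid ++ [ y ]
      length≥1 : ∀ (xs : List (Fin n)) → 1 ≤ length (xs ++ [ y ])
      length≥1 []       = s≤s z≤n
      length≥1 (_ ∷ xs) = s≤s z≤n
      p∉ : All (par x ≢_) L
      p∉ = All.map (λ {z} k<z eq → <⇒≱ k<z (≤-reflexive (trans (cong depth (sym eq)) (suc-injective (trans (sym (par-depth x≢r)) dx))))) d
    ... | no px≢py = ascend k (par x) L (par y) dpx dpy
        (Allₚ.++⁺ (p∉ dpx) (px≢py ∷ []) ∷ AllPairsₚ.++⁺ u ([] ∷ []) (All.map (λ ne → (λ eq → ne (sym eq)) ∷ []) (p∉ dpy)))
        (adj-sym (par-adj x≢r) ∷ linked-snoc (x ∷ mid) l (par-adj y≢r))
        (≤-reflexive (sym dpx) ∷ Allₚ.++⁺ (All.map <⇒≤ d) (≤-reflexive (sym dpy) ∷ []))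
      where
      x≢r = below dx
      y≢r = below dy
      L = x ∷ mid ++ [ y ]
      dpx = suc-injective (trans (sym (par-depth x≢r)) dx)
      dpy = suc-injective (trans (sym (par-depth y≢r)) dy)
      p∉ : ∀ {p} → depth p ≡ k → All (p ≢_) L
      p∉ dp = All.map (λ {z} k<z eq → <⇒≱ k<z (≤-reflexive (trans (cong depth (sym eq)) dp))) d

  -- An edge inside one level is already a path to which `ascend` applies.
  adj⇒depth≢ : ∀ {x y} → Adj G x y → depth x ≢ depth y
  adj⇒depth≢ {x} {y} a eq = acyclic (ascend (depth x) x [] y refl (sym eq)
    ((adj⇒≢ a ∷ []) ∷ [] ∷ []) (a ∷ [-]) (≤-refl ∷ ≤-reflexive eq ∷ []))

  -- A second neighbour one level closer to the root would give the path `par x`, x, y with both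
  -- ends in one level, which `ascend` turns into a cycle.
  par-unique : ∀ {x y} → Adj G x y → depth x ≡ suc (depth y) → par x ≡ y
  par-unique {x} {y} a d with par x ≟ y
  ... | yes eq = eq
  ... | no  ne = contradiction (ascend (depth y) (par x) [ x ] y dp refl
      ((par-≢ x≢r ∷ ne ∷ []) ∷ (adj⇒≢ a ∷ []) ∷ [] ∷ []) (adj-sym (par-adj x≢r) ∷ a ∷ [-])
      (≤-reflexive (sym dp) ∷ ≤-trans (n≤1+n _) (≤-reflexive (sym d)) ∷ ≤-refl ∷ [])) acyclic
    where
    x≢r = below d
    dp = suc-injective (trans (sym (par-depth x≢r)) d)

  adj-cases : ∀ {x y} → Adj G x y → (x ≢ r × par x ≡ y) ⊎ (y ≢ r × par y ≡ x)
  adj-cases {x} {y} a with <-cmp (depth x) (depth y)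
  ... | tri≈ _ eq _ = contradiction eq (adj⇒depth≢ a)
  ... | tri< lt _ _ = inj₂ (below d , par-unique (adj-sym a) d)
    where d = ≤-antisym (dist-adj r (adj-sym a)) lt
  ... | tri> _ _ gt = inj₁ (below d , par-unique a d)
    where d = ≤-antisym (dist-adj r a) gt

  colour : Fin n → Bool
  colour x = even (depth x)

  par-colour : ∀ {x} → x ≢ r → colour x ≡ not (colour (par x))
  par-colour x≢r = cong even (par-depth x≢r)

  adj-colour : ∀ {x y} → Adj G x y → colour x ≡ not (colour y)
  adj-colour {x} {y} a with adj-cases a
  ... | inj₁ (x≢r , refl) = par-colour x≢r
  ... | inj₂ (y≢r , refl) = trans (sym (Boolₚ.not-involutive (colour x))) (cong not (sym (par-colour y≢r)))

  walk₂-colour : ∀ {a b c} → Adj G a b → Adj G b c → colour a ≡ colour c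
  walk₂-colour {c = c} ab bc = trans (adj-colour ab) (trans (cong not (adj-colour bc)) (Boolₚ.not-involutive (colour c)))

  walk₃-colour : ∀ {a b c d} → Adj G a b → Adj G b c → Adj G c d → colour a ≡ not (colour d)
  walk₃-colour ab bc cd = trans (adj-colour ab) (cong not (walk₂-colour bc cd))

  walk₃⇒≢ : ∀ {a b c d} → Adj G a b → Adj G b c → Adj G c d → a ≢ d
  walk₃⇒≢ {a} ab bc cd refl = Boolₚ.not-¬ refl (walk₃-colour ab bc cd)

  no-C₄ : ∀ {a b c d} → Adj G a b → Adj G b c → Adj G c d → Adj G d a → a ≢ c → b ≢ d → ⊥
  no-C₄ {a} {b} {c} {d} ab bc cd da a≢c b≢d = acyclic (a , b ∷ c ∷ d ∷ [] ,
    ((adj⇒≢ ab ∷ a≢c ∷ ≢-sym (adj⇒≢ da) ∷ []) ∷ (adj⇒≢ bc ∷ b≢d ∷ []) ∷ (adj⇒≢ cd ∷ []) ∷ [] ∷ []) ,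
    s≤s (s≤s z≤n) , ab ∷ bc ∷ cd ∷ da ∷ [-])

  -- Opposite vertices of the hexagon have different colours, so only distinctness within each
  -- colour class has to be assumed.
  no-C₆ : ∀ {a b c d e f} → Adj G a b → Adj G b c → Adj G c d → Adj G d e → Adj G e f → Adj G f a →
    a ≢ c → a ≢ e → c ≢ e → b ≢ d → b ≢ f → d ≢ f → ⊥
  no-C₆ {a} {b} {c} {d} {e} {f} ab bc cd de ef fa a≢c a≢e c≢e b≢d b≢f d≢f = acyclic (a , b ∷ c ∷ d ∷ e ∷ f ∷ [] ,
    ((adj⇒≢ ab ∷ a≢c ∷ a≢d ∷ a≢e ∷ ≢-sym (adj⇒≢ fa) ∷ []) ∷ (adj⇒≢ bc ∷ b≢d ∷ b≢e ∷ b≢f ∷ []) ∷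
     (adj⇒≢ cd ∷ c≢e ∷ c≢f ∷ []) ∷ (adj⇒≢ de ∷ d≢f ∷ []) ∷ (adj⇒≢ ef ∷ []) ∷ [] ∷ []) ,
    s≤s (s≤s z≤n) , ab ∷ bc ∷ cd ∷ de ∷ ef ∷ fa ∷ [-])
    where
    a≢d = walk₃⇒≢ ab bc cd
    b≢e = walk₃⇒≢ bc cd de
    c≢f = walk₃⇒≢ cd de ef

-- Matchings as involutions

moved : (Fin n → Fin n) → Fin n → ℕ
moved σ x = if does (σ x ≟ x) then 0 else 1

moved-≡ : (σ : Fin n → Fin n) → ∀ {x} → σ x ≡ x → moved σ x ≡ 0
moved-≡ σ {x} eq with σ x ≟ x
... | yes _ = refl
... | no ne = contradiction eq ne

moved-≢ : (σ : Fin n → Fin n) → ∀ {x} → σ x ≢ x → moved σ x ≡ 1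
moved-≢ σ {x} ne with σ x ≟ x
... | yes eq = contradiction eq ne
... | no _   = refl

endpoints : List (Fin n × Fin n) → List (Fin n)
endpoints []            = []
endpoints ((a , b) ∷ M) = a ∷ b ∷ endpoints M

concatMap-endpoints : (f : Fin n × Fin n → List (Fin n)) → (∀ a b → f (a , b) ≡ a ∷ b ∷ []) →
  ∀ M → concatMap f M ≡ endpoints M
concatMap-endpoints f h []            = refl
concatMap-endpoints f h ((a , b) ∷ M) = cong₂ _++_ (h a b) (concatMap-endpoints f h M)

-- A matching, viewed as the involution that swaps the ends of its edges.
record Mating (G : Graph n) (β : ℕ) : Set where
  field
    mate       : Fin n → Fin n
    involutive : ∀ x → mate (mate x) ≡ x
    mate-adj   : ∀ {x} → mate x ≢ x → Adj G x (mate x)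
    moved-sum  : sum (moved mate) ≡ 2 * β

  mate-injective : ∀ {x y} → mate x ≡ mate y → x ≡ y
  mate-injective {x} {y} eq = trans (sym (involutive x)) (trans (cong mate eq) (involutive y))

module _ (G : Graph n) (simple : IsSimple G) where

  private
    adj-sym : ∀ {x y} → Adj G x y → Adj G y x
    adj-sym {x} {y} a = trans (sym (proj₁ simple x y)) a

    adj⇒≢ : ∀ {x y} → Adj G x y → x ≢ y
    adj⇒≢ {x} a refl = contradiction (trans (sym a) (proj₂ simple x)) λ ()

  open Mating

  -- The two additional facts identify the fixed points with the vertices off the matching. One
  -- feeds the induction, as the ends of a new edge must be fixed so far; the other shows that an
  -- edge between fixed points would extend the matching.
  mating : ∀ M → All (λ { (a , b) → Adj G a b }) M → Unique (endpoints M) →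
    ∃ λ (μ : Mating G (length M)) → (∀ x → mate μ x ≡ x → All (x ≢_) (endpoints M)) × (∀ x → All (x ≢_) (endpoints M) → mate μ x ≡ x)
  mating [] _ _ = record
    { mate = id ; involutive = λ _ → refl ; mate-adj = λ ne → contradiction refl ne
    ; moved-sum = trans (sum-cong-≗ {n} (λ x → moved-≡ id {x} refl)) (trans (sum-const n 0) (*-zeroʳ n)) } , (λ _ _ → []) , (λ _ _ → refl)
  mating ((a , b) ∷ M) (ab ∷ as) ((a≢b ∷ a∉) ∷ b∉ ∷ u) with mating M as u
  ... | μ , fixed⇒∉ , ∉⇒fixed = record
    { mate = σ ; involutive = σ-inv ; mate-adj = σ-adj ; moved-sum = σ-sum } , σ-fixed , σ-∉
    where
    σ : Fin n → Fin n
    σ x with x ≟ a | x ≟ b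
    ... | yes _ | _     = b
    ... | no _  | yes _ = a
    ... | no _  | no _  = mate μ x

    σ-a : σ a ≡ b
    σ-a with a ≟ a | a ≟ b
    ... | yes _ | _ = refl
    ... | no ne | _ = contradiction refl ne

    σ-b : σ b ≡ a
    σ-b with b ≟ a | b ≟ b
    ... | yes eq | _     = contradiction (sym eq) a≢b
    ... | no _   | yes _ = refl
    ... | no _   | no ne = contradiction refl ne

    σ-else : ∀ {x} → x ≢ a → x ≢ b → σ x ≡ mate μ x
    σ-else {x} x≢a x≢b with x ≟ a | x ≟ b
    ... | yes eq | _      = contradiction eq x≢a
    ... | no _   | yes eq = contradiction eq x≢b
    ... | no _   | no _   = refl

    data View (x : Fin n) : Set where
      is-a  : x ≡ a → View x
      is-b  : x ≡ b → View x
      other : x ≢ a → x ≢ b → View x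

    view : ∀ x → View x
    view x with x ≟ a | x ≟ b
    ... | yes eq | _      = is-a eq
    ... | no _   | yes eq = is-b eq
    ... | no p   | no q   = other p q

    τ : Fin n → Fin n
    τ = mate μ

    τ-avoids : ∀ {x y} → τ y ≡ y → x ≢ y → τ x ≢ y
    τ-avoids {x} {y} τy x≢y τx = x≢y (trans (sym (involutive μ x)) (trans (cong τ τx) τy))

    τ-a : τ a ≡ a
    τ-a = ∉⇒fixed a a∉

    τ-b : τ b ≡ b
    τ-b = ∉⇒fixed b b∉

    σ-inv : ∀ x → σ (σ x) ≡ x
    σ-inv x with view x
    ... | is-a refl = trans (cong σ σ-a) σ-b
    ... | is-b refl = trans (cong σ σ-b) σ-a
    ... | other p q = trans (cong σ (σ-else p q)) (trans (σ-else (τ-avoids τ-a p) (τ-avoids τ-b q)) (involutive μ x))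

    σ-adj : ∀ {x} → σ x ≢ x → Adj G x (σ x)
    σ-adj {x} ne with view x
    ... | is-a refl = subst (Adj G a) (sym σ-a) ab
    ... | is-b refl = subst (Adj G b) (sym σ-b) (adj-sym ab)
    ... | other p q = subst (Adj G x) (sym (σ-else p q)) (mate-adj μ (ne ∘ trans (σ-else p q)))

    σ-fixed : ∀ x → σ x ≡ x → All (x ≢_) (a ∷ b ∷ endpoints M)
    σ-fixed x eq with view x
    ... | is-a refl = contradiction (trans (sym eq) σ-a) a≢b
    ... | is-b refl = contradiction (trans (sym σ-b) eq) a≢b
    ... | other p q = p ∷ q ∷ fixed⇒∉ x (trans (sym (σ-else p q)) eq)

    σ-∉ : ∀ x → All (x ≢_) (a ∷ b ∷ endpoints M) → σ x ≡ x
    σ-∉ x (p ∷ q ∷ x∉) = trans (σ-else p q) (∉⇒fixed x x∉)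

    pointwise : ∀ x → moved σ x ≡ δ a x + (δ b x + moved τ x)
    pointwise x with view x
    ... | is-a refl rewrite δ-refl a | δ-≢ (≢-sym a≢b) | moved-≡ τ τ-a = moved-≢ σ (λ eq → a≢b (trans (sym eq) σ-a))
    ... | is-b refl rewrite δ-refl b | δ-≢ a≢b | moved-≡ τ τ-b = moved-≢ σ (λ eq → a≢b (trans (sym σ-b) eq))
    ... | other p q rewrite δ-≢ (≢-sym p) | δ-≢ (≢-sym q) | σ-else p q = refl

    σ-sum : sum (moved σ) ≡ 2 * suc (length M)
    σ-sum = begin
      sum (moved σ)                                 ≡⟨ sum-cong-≗ pointwise ⟩
      sum (λ x → δ a x + (δ b x + moved τ x))       ≡⟨ ∑-distrib-+ (δ a) _ ⟩
      sum (δ a) + sum (λ x → δ b x + moved τ x)     ≡⟨ cong (sum (δ a) +_) (∑-distrib-+ (δ b) (moved τ)) ⟩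
      sum (δ a) + (sum (δ b) + sum (moved τ))       ≡⟨ cong₂ _+_ (sum-δ₁ a) (cong₂ _+_ (sum-δ₁ b) (moved-sum μ)) ⟩
      1 + (1 + 2 * length M)                        ≡⟨ *-suc 2 (length M) ⟨
      2 * suc (length M)                            ∎
      where open ≡-Reasoning

  module _ {β} (max : IsMatchingNumber G β) where

    private
      M = proj₁ (proj₁ max)
      isM = proj₁ (proj₂ (proj₁ max))
      len = proj₂ (proj₂ (proj₁ max))
      μ = mating M (proj₁ isM) (subst Unique (concatMap-endpoints _ (λ _ _ → refl) M) (proj₂ isM))

    maximum : Mating G β
    maximum = subst (Mating G) len (proj₁ μ)

    -- Two adjacent unmatched vertices would extend the maximum matching.
    unmatched-independent : ∀ {x y} → mate maximum x ≡ x → mate maximum y ≡ y → ¬ Adj G x y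
    unmatched-independent {x} {y} mx my xy = <⇒≱ (≤-reflexive (cong suc (sym len)))
      (proj₂ max ((x , y) ∷ M) (xy ∷ proj₁ isM , (adj⇒≢ xy ∷ avoid mx) ∷ avoid my ∷ proj₂ isM))
      where
      mate-subst : ∀ {k} (eq : length M ≡ k) z → mate (subst (Mating G) eq (proj₁ μ)) z ≡ mate (proj₁ μ) z
      mate-subst refl z = refl
      avoid : ∀ {z} → mate maximum z ≡ z → All (z ≢_) (concatMap _ M)
      avoid {z} mz = subst (All (z ≢_)) (sym (concatMap-endpoints _ (λ _ _ → refl) M))
        (proj₁ (proj₂ μ) z (trans (sym (mate-subst len z)) mz))

    edge⇒1≤β : ∀ {x y} → Adj G x y → 1 ≤ β
    edge⇒1≤β {x} {y} xy = proj₂ max ((x , y) ∷ []) (xy ∷ [] , (adj⇒≢ xy ∷ []) ∷ [] ∷ [])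

-- Weights bounding inverse distances

inv≤ : ∀ {d k w} → suc k ≤ d → w * suc k ≡ 24 → inv d ℚ.≤ w /24
inv≤ {suc d} {k} {w} k<d eq = /-mono 1 d w 23
  (≤-trans (≤-reflexive (trans (+-identityʳ 24) (sym eq))) (*-monoʳ-≤ w k<d))

module Weight (G : Graph n) (tree : IsTree G) (r : Fin n) where

  open RootedTree G tree r
  open Distance G (proj₁ (proj₂ tree))

  Common : Fin n → Fin n → Set
  Common x y = ∃ λ z → Adj G x z × Adj G z y

  adj? : ∀ x y → Dec (Adj G x y)
  adj? x y = G x y Boolₚ.≟ true

  common? : ∀ x y → Dec (Common x y)
  common? x y = Finₚ.any? λ z → adj? x z ×-dec adj? z y

  -- 24 / k for a lower bound k ≤ 4 of the distance between x and y
  weight : Fin n → Fin n → ℕ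
  weight x y with x ≟ y | adj? x y | colour x Boolₚ.≟ colour y | common? x y
  ... | yes _ | _     | _     | _     = 0
  ... | no _  | yes _ | _     | _     = 24
  ... | no _  | no _  | yes _ | yes _ = 12
  ... | no _  | no _  | yes _ | no _  = 6
  ... | no _  | no _  | no _  | _     = 8

  data View (x y : Fin n) : ℕ → Set where
    equal    : x ≡ y → View x y 0
    adjacent : Adj G x y → View x y 24
    common   : x ≢ y → colour x ≡ colour y → Common x y → View x y 12
    far-even : x ≢ y → colour x ≡ colour y → ¬ Common x y → View x y 6
    far-odd  : ¬ Adj G x y → colour x ≢ colour y → View x y 8

  view : ∀ x y → View x y (weight x y)
  view x y with x ≟ y | adj? x y | colour x Boolₚ.≟ colour y | common? x y
  ... | yes p | _     | _     | _     = equal p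
  ... | no _  | yes p | _     | _     = adjacent p
  ... | no o  | no _  | yes p | yes q = common o p q
  ... | no p  | no _  | yes q | no s  = far-even p q s
  ... | no _  | no p  | no q  | _     = far-odd p q

  adj⇒colour≢ : ∀ {x y} → Adj G x y → colour x ≢ colour y
  adj⇒colour≢ a eq = Boolₚ.not-¬ eq (adj-colour a)

  common-sym : ∀ {x y} → Common x y → Common y x
  common-sym (z , a , b) = z , adj-sym b , adj-sym a

  weight-sym : ∀ x y → weight x y ≡ weight y x
  weight-sym x y = go (view x y) (view y x)
    where
    go : ∀ {v w} → View x y v → View y x w → v ≡ w
    go (equal _)          (equal _)          = refl
    go (equal refl)       (adjacent a)       = contradiction refl (adj⇒≢ a)
    go (equal eq)         (common ne _ _)    = contradiction (sym eq) ne
    go (equal eq)         (far-even ne _ _)  = contradiction (sym eq) ne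
    go (equal refl)       (far-odd _ ne)     = contradiction refl ne
    go (adjacent a)       (equal refl)       = contradiction refl (adj⇒≢ a)
    go (adjacent _)       (adjacent _)       = refl
    go (adjacent a)       (common _ c _)     = contradiction (sym c) (adj⇒colour≢ a)
    go (adjacent a)       (far-even _ c _)   = contradiction (sym c) (adj⇒colour≢ a)
    go (adjacent a)       (far-odd ¬a _)     = contradiction (adj-sym a) ¬a
    go (common ne _ _)    (equal eq)         = contradiction (sym eq) ne
    go (common _ c _)     (adjacent a)       = contradiction (sym c) (adj⇒colour≢ a)
    go (common _ _ _)     (common _ _ _)     = refl
    go (common _ _ z)     (far-even _ _ ¬z)  = contradiction (common-sym z) ¬z
    go (common _ c _)     (far-odd _ ne)     = contradiction (sym c) ne
    go (far-even ne _ _)  (equal eq)         = contradiction (sym eq) ne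
    go (far-even _ c _)   (adjacent a)       = contradiction (sym c) (adj⇒colour≢ a)
    go (far-even _ _ ¬z)  (common _ _ z)     = contradiction (common-sym z) ¬z
    go (far-even _ _ _)   (far-even _ _ _)   = refl
    go (far-even _ c _)   (far-odd _ ne)     = contradiction (sym c) ne
    go (far-odd _ ne)     (equal refl)       = contradiction refl ne
    go (far-odd ¬a _)     (adjacent a)       = contradiction (adj-sym a) ¬a
    go (far-odd _ ne)     (common _ c _)     = contradiction (sym c) ne
    go (far-odd _ ne)     (far-even _ c _)   = contradiction (sym c) ne
    go (far-odd _ _)      (far-odd _ _)      = refl

  weight-diag : ∀ x → weight x x ≡ 0
  weight-diag x with weight x x | view x x
  ... | _ | equal _         = refl
  ... | _ | adjacent a      = contradiction refl (adj⇒≢ a)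
  ... | _ | common ne _ _   = contradiction refl ne
  ... | _ | far-even ne _ _ = contradiction refl ne
  ... | _ | far-odd _ ne    = contradiction refl ne

  weight-adj : ∀ {x y} → Adj G x y → weight x y ≡ 24
  weight-adj {x} {y} a with weight x y | view x y
  ... | _ | equal refl     = contradiction refl (adj⇒≢ a)
  ... | _ | adjacent _     = refl
  ... | _ | common _ c _   = contradiction c (adj⇒colour≢ a)
  ... | _ | far-even _ c _ = contradiction c (adj⇒colour≢ a)
  ... | _ | far-odd ¬a _   = contradiction a ¬a

  private
    ≤′ : ∀ {m n} {_ : T (m ≤ᵇ n)} → m ≤ n
    ≤′ {m} {n} {t} = ≤ᵇ⇒≤ m n t

  weight-nonadj : ∀ {x y} → ¬ Adj G x y → weight x y ≤ 12
  weight-nonadj {x} {y} ¬a with weight x y | view x y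
  ... | _ | equal _        = ≤′
  ... | _ | adjacent a     = contradiction a ¬a
  ... | _ | common _ _ _   = ≤′
  ... | _ | far-even _ _ _ = ≤′
  ... | _ | far-odd _ _    = ≤′

  weight-even : ∀ {x y} → colour x ≡ colour y → weight x y ≤ 12
  weight-even c = weight-nonadj λ a → adj⇒colour≢ a c

  weight-far-even : ∀ {x y} → colour x ≡ colour y → ¬ Common x y → weight x y ≤ 6
  weight-far-even {x} {y} c ¬z with weight x y | view x y
  ... | _ | equal _        = ≤′
  ... | _ | adjacent a     = contradiction c (adj⇒colour≢ a)
  ... | _ | common _ _ z   = contradiction z ¬z
  ... | _ | far-even _ _ _ = ≤′
  ... | _ | far-odd _ ne   = contradiction c ne

  weight-far : ∀ {x y} → ¬ Adj G x y → ¬ Common x y → weight x y ≤ 8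
  weight-far {x} {y} ¬a ¬z with weight x y | view x y
  ... | _ | equal _        = ≤′
  ... | _ | adjacent a     = contradiction a ¬a
  ... | _ | common _ _ z   = contradiction z ¬z
  ... | _ | far-even _ _ _ = ≤′
  ... | _ | far-odd _ _    = ≤′

  -- An edge has weight 24 = 8 + 16. Keeping the adjacency bit in the bound lets edges be counted by
  -- the sums.
  weight-odd : ∀ {x y} → colour x ≢ colour y → weight x y ≤ 8 + 16 * bit (G x y)
  weight-odd {x} {y} ne with weight x y | view x y
  ... | _ | equal _        = z≤n
  ... | _ | adjacent a     rewrite a = ≤′
  ... | _ | common _ c _   = contradiction c ne
  ... | _ | far-even _ c _ = contradiction c ne
  ... | _ | far-odd _ _    = m≤m+n 8 _

  dist≡1⇒adj : ∀ x y → dist G x y ≡ 1 → Adj G x y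
  dist≡1⇒adj x y d = let z , a , d' = dist-descend {j = 0} x y d in subst (Adj G x) (dist≡0⇒≡ z y d') a

  dist≡2⇒common : ∀ x y → dist G x y ≡ 2 → Common x y
  dist≡2⇒common x y d = let z , a , d' = dist-descend {j = 1} x y d in z , a , dist≡1⇒adj z y d'

  dist≡3⇒colour : ∀ x y → dist G x y ≡ 3 → colour x ≢ colour y
  dist≡3⇒colour x y d c =
    let z , a , d' = dist-descend {j = 2} x y d
        w , b , b' = dist≡2⇒common z y d'
    in Boolₚ.not-¬ c (walk₃-colour a b b')

  -- The distances 0, 1, 2, 3 are excluded in turn, as far as the weight demands: parity removes
  -- those of the wrong kind, the case at hand the others.
  inv-dist≤ : ∀ {x y w} → View x y w → inv (dist G x y) ℚ.≤ w /24
  inv-dist≤ {x} (equal refl) = ℚₚ.≤-reflexive (cong inv (dist-refl x))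
  inv-dist≤ {x} {y} (adjacent a) = inv≤ {d = dist G x y} {k = 0} {w = 24} (≤∧≢⇒< z≤n λ d → adj⇒≢ a (dist≡0⇒≡ x y (sym d))) refl
  inv-dist≤ {x} {y} (common ne c _) = inv≤ {d = dist G x y} {k = 1} {w = 12} (≤∧≢⇒< (≤∧≢⇒< z≤n
    (λ d → ne (dist≡0⇒≡ x y (sym d)))) (λ d → adj⇒colour≢ (dist≡1⇒adj x y (sym d)) c)) refl
  inv-dist≤ {x} {y} (far-even ne c ¬z) = inv≤ {d = dist G x y} {k = 3} {w = 6} (≤∧≢⇒< (≤∧≢⇒< (≤∧≢⇒< (≤∧≢⇒< z≤n
    (λ d → ne (dist≡0⇒≡ x y (sym d)))) (λ d → adj⇒colour≢ (dist≡1⇒adj x y (sym d)) c))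
    (λ d → ¬z (dist≡2⇒common x y (sym d)))) (λ d → dist≡3⇒colour x y (sym d) c)) refl
  inv-dist≤ {x} {y} (far-odd ¬a ne) = inv≤ {d = dist G x y} {k = 2} {w = 8} (≤∧≢⇒< (≤∧≢⇒< (≤∧≢⇒< z≤n
    (λ d → ne (cong colour (dist≡0⇒≡ x y (sym d))))) (λ d → ¬a (dist≡1⇒adj x y (sym d))))
    (λ d → let z , a , b = dist≡2⇒common x y (sym d) in ne (walk₂-colour a b))) refl

  inv-dist≤weight : ∀ x y → inv (dist G x y) ℚ.≤ weight x y /24
  inv-dist≤weight x y = inv-dist≤ (view x y)

-- Pairs of pieces of the matching

module Pieces (G : Graph n) (tree : IsTree G) (r : Fin n) {β : ℕ} (M : Mating G β)
  (independent : ∀ {x y} → Mating.mate M x ≡ x → Mating.mate M y ≡ y → ¬ Adj G x y) where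

  open RootedTree G tree r
  open Weight G tree r
  open Mating M

  a : Fin n → Fin n → ℕ
  a x y = bit (G x y)

  μ : Fin n → ℕ
  μ = moved mate

  a-sym : ∀ x y → a x y ≡ a y x
  a-sym x y = cong bit (proj₁ (proj₁ tree) x y)

  a-adj : ∀ {x y} → Adj G x y → a x y ≡ 1
  a-adj = cong bit

  a-nonadj : ∀ {x y} → ¬ Adj G x y → a x y ≡ 0
  a-nonadj ¬xy = cong bit (Boolₚ.¬-not ¬xy)

  -- An unmatched vertex is its own mate, so pairs involving it are counted with multiplicity.
  block : (Fin n → Fin n → ℕ) → Fin n → Fin n → ℕ
  block f x y = (f x y + f (mate x) (mate y)) + (f x (mate y) + f (mate x) y)

  -- If both pairs had common neighbours z and w, then p z q q′ w p′ would be a 6-cycle; the missing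
  -- edges p q′ and p′ q keep z and w away from the four ends. So one pair has weight at most 6, and
  -- 12 + 6 = 18.
  even-pair : ∀ {p p′ q q′} → Adj G p p′ → Adj G q q′ → colour p ≡ colour q → colour p′ ≡ colour q′ →
    p ≢ q → p′ ≢ q′ → ¬ Adj G p q′ → ¬ Adj G p′ q → weight p q + weight p′ q′ ≤ 18
  even-pair {p} {p′} {q} {q′} pp′ qq′ c c′ p≢q p′≢q′ ¬pq′ ¬p′q = go (common? p q) (common? p′ q′)
    where
    go : Dec (Common p q) → Dec (Common p′ q′) → weight p q + weight p′ q′ ≤ 18
    go (yes (z , pz , zq)) (yes (w , p′w , wq′)) = ⊥-elim (no-C₆ pz zq qq′ (adj-sym wq′) (adj-sym p′w) (adj-sym pp′)
      p≢q (λ { refl → ¬pq′ wq′ }) (λ { refl → ¬p′q p′w })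
      (λ { refl → ¬pq′ pz }) (λ { refl → ¬p′q zq }) (≢-sym p′≢q′))
    go (no ¬z) _       = +-mono-≤ (weight-far-even c ¬z) (weight-even c′)
    go (yes _) (no ¬w) = +-mono-≤ (weight-even c) (weight-far-even c′ ¬w)

  -- Equal colours of p and q make p q and p′ q′ the even pairs. Two cross edges would close a
  -- 4-cycle. One cross edge gives 12 + 12 + 24 + 8 = 56, none gives 18 + 8 + 8 = 34, and 22 is the
  -- difference.
  two-edges : ∀ {p p′ q q′} → Adj G p p′ → Adj G q q′ → colour p ≡ colour q → p ≢ q → p′ ≢ q′ →
    (weight p q + weight p′ q′) + (weight p q′ + weight p′ q) ≤ 34 + 22 * (a p q′ + a p′ q)
  two-edges {p} {p′} {q} {q′} pp′ qq′ c p≢q p′≢q′ = go (adj? p q′) (adj? p′ q)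
    where
    open ≤-Reasoning
    c′ : colour p′ ≡ colour q′
    c′ = Boolₚ.not-injective (trans (sym (adj-colour pp′)) (trans c (adj-colour qq′)))
    odd : colour p ≢ colour q′
    odd eq = adj⇒colour≢ qq′ (trans (sym c) eq)
    odd′ : colour p′ ≢ colour q
    odd′ eq = adj⇒colour≢ pp′ (trans c (sym eq))
    W = (weight p q + weight p′ q′) + (weight p q′ + weight p′ q)
    near : a p q′ + a p′ q ≡ 1 → W ≤ 34 + 22 * (a p q′ + a p′ q)
    near eq = begin
      W ≤⟨ +-mono-≤ (+-mono-≤ (weight-even c) (weight-even c′)) (+-mono-≤ (weight-odd odd) (weight-odd odd′)) ⟩
      24 + ((8 + 16 * a p q′) + (8 + 16 * a p′ q))  ≡⟨ identity (a p q′) (a p′ q) ⟩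
      40 + 16 * (a p q′ + a p′ q)                   ≡⟨ cong (λ s → 40 + 16 * s) eq ⟩
      56                                            ≡⟨ cong (λ s → 34 + 22 * s) eq ⟨
      34 + 22 * (a p q′ + a p′ q)                   ∎
      where
      identity : ∀ s t → 24 + ((8 + 16 * s) + (8 + 16 * t)) ≡ 40 + 16 * (s + t)
      identity = solve-∀
    go : Dec (Adj G p q′) → Dec (Adj G p′ q) → W ≤ 34 + 22 * (a p q′ + a p′ q)
    go (yes pq′) (yes p′q) = ⊥-elim (no-C₄ pq′ (adj-sym qq′) (adj-sym p′q) (adj-sym pp′) p≢q (≢-sym p′≢q′))
    go (yes pq′) (no ¬p′q) = near (cong₂ _+_ (a-adj pq′) (a-nonadj ¬p′q))
    go (no ¬pq′) (yes p′q) = near (cong₂ _+_ (a-nonadj ¬pq′) (a-adj p′q))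
    go (no ¬pq′) (no ¬p′q) = begin
      W          ≤⟨ +-mono-≤ (even-pair pp′ qq′ c c′ p≢q p′≢q′ ¬pq′ ¬p′q) (+-mono-≤ (weight-odd odd) (weight-odd odd′)) ⟩
      18 + ((8 + 16 * a p q′) + (8 + 16 * a p′ q)) ≡⟨ cong₂ (λ s t → 18 + ((8 + 16 * s) + (8 + 16 * t))) (a-nonadj ¬pq′) (a-nonadj ¬p′q) ⟩
      34         ≤⟨ m≤m+n 34 _ ⟩
      34 + 22 * (a p q′ + a p′ q) ∎

  -- Exactly one end of the edge has the colour of p and weighs at most 12; the other weighs at most
  -- 8, or 24 if it is adjacent to p.
  vertex-edge : ∀ {p q q′} → Adj G q q′ → weight p q + weight p q′ ≤ 20 + 16 * (a p q + a p q′)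
  vertex-edge {p} {q} {q′} qq′ = go (colour p Boolₚ.≟ colour q)
    where
    open ≤-Reasoning
    go : Dec (colour p ≡ colour q) → weight p q + weight p q′ ≤ 20 + 16 * (a p q + a p q′)
    go (yes c) = begin
      weight p q + weight p q′    ≤⟨ +-mono-≤ (weight-even c) (weight-odd λ c′ → adj⇒colour≢ qq′ (trans (sym c) c′)) ⟩
      20 + 16 * a p q′            ≤⟨ +-monoʳ-≤ 20 (*-monoʳ-≤ 16 (m≤n+m _ (a p q))) ⟩
      20 + 16 * (a p q + a p q′)  ∎
    go (no ne) = begin
      weight p q + weight p q′    ≤⟨ +-mono-≤ (weight-odd ne) (weight-even c′) ⟩
      8 + 16 * a p q + 12         ≡⟨ +-comm (8 + 16 * a p q) 12 ⟩
      20 + 16 * a p q             ≤⟨ +-monoʳ-≤ 20 (*-monoʳ-≤ 16 (m≤m+n (a p q) (a p q′))) ⟩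
      20 + 16 * (a p q + a p q′)  ∎
      where
      c′ : colour p ≡ colour q′
      c′ = trans (Boolₚ.¬-not ne) (sym (adj-colour (adj-sym qq′)))

  -- F, A: weight and adjacency blocks; D: multiplicity with which the two pieces coincide;
  -- i, j: whether the pieces are matching edges.
  Shape : (F D A i j : ℕ) → Set
  Shape F D A i j = F + D * (24 + 6 * i) + 8 * (i + j) ≤ 48 + 2 * (i * j) + (10 + 6 * (i + j)) * A

  D : Fin n → Fin n → ℕ
  D x y = δ x y + δ (mate x) y

  private
    -- For two, one and no matching edges, `48 + 2ij − 8(i + j)` takes the values 34, 40, 48 and
    -- `10 + 6(i + j)` the values 22, 16, 10. The values 40 and 48 are 2 · 20 and 4 · 12, because a
    -- block repeats the pairs at an unmatched vertex. Being polynomials in i and j, these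
    -- coefficients can be summed term by term.
    shape₁₁ : ∀ {F A} → F ≤ 34 + 22 * A → Shape F 0 A 1 1
    shape₁₁ {F} {A} le = ≤-trans (≤-reflexive (cong (_+ 16) (+-identityʳ F)))
      (≤-trans (+-monoˡ-≤ 16 le) (≤-reflexive (identity A)))
      where
      identity : ∀ A → 34 + 22 * A + 16 ≡ 50 + 22 * A
      identity = solve-∀

    half : ∀ {F A} → F ≤ 40 + 16 * A → F + 8 ≤ 48 + 16 * A
    half {F} {A} le = ≤-trans (+-monoˡ-≤ 8 le) (≤-reflexive (identity A))
      where
      identity : ∀ A → 40 + 16 * A + 8 ≡ 48 + 16 * A
      identity = solve-∀

    shape₀₁ : ∀ {F A} → F ≤ 40 + 16 * A → Shape F 0 A 0 1
    shape₀₁ {F} {A} le = ≤-trans (≤-reflexive (cong (_+ 8) (+-identityʳ F))) (half {F} {A} le)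

    shape₁₀ : ∀ {F A} → F ≤ 40 + 16 * A → Shape F 0 A 1 0
    shape₁₀ {F} {A} le = ≤-trans (≤-reflexive (cong (_+ 8) (+-identityʳ F))) (half {F} {A} le)

    shape₀₀ : ∀ {F A} → F ≤ 48 → Shape F 0 A 0 0
    shape₀₀ {F} {A} le = ≤-trans (≤-reflexive (trans (+-identityʳ (F + 0)) (+-identityʳ F))) (≤-trans le (m≤m+n 48 _))

    double : ∀ s t → s + t + (t + s) ≡ 2 * (s + t)
    double = solve-∀

    double′ : ∀ s t → s + t + (s + t) ≡ 2 * (s + t)
    double′ = solve-∀

    twice : ∀ {s t} → s ≤ 20 + 16 * t → 2 * s ≤ 40 + 16 * (2 * t)
    twice {s} {t} le = ≤-trans (*-monoʳ-≤ 2 le) (≤-reflexive (identity t))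
      where
      identity : ∀ t → 2 * (20 + 16 * t) ≡ 40 + 16 * (2 * t)
      identity = solve-∀

  D-≢ : ∀ {x y} → x ≢ y → mate x ≢ y → D x y ≡ 0
  D-≢ p q = cong₂ _+_ (δ-≢ p) (δ-≢ q)

  matched-matched : ∀ {x y} → mate x ≢ x → mate y ≢ y → x ≢ y → mate x ≢ y →
    block weight x y ≤ 34 + 22 * block a x y
  matched-matched {x} {y} mx my x≢y mx≢y = go (colour x Boolₚ.≟ colour y)
    where
    xx′ = mate-adj mx
    yy′ = mate-adj my
    x′≢y′ : mate x ≢ mate y
    x′≢y′ eq = x≢y (mate-injective eq)
    x≢y′ : x ≢ mate y
    x≢y′ eq = mx≢y (trans (cong mate eq) (involutive y))
    go : Dec (colour x ≡ colour y) → block weight x y ≤ 34 + 22 * block a x y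
    go (yes c) = ≤-trans (two-edges xx′ yy′ c x≢y x′≢y′) (+-monoʳ-≤ 34 (*-monoʳ-≤ 22 (m≤n+m _ (a x y + a (mate x) (mate y)))))
    -- When x and y have different colours, x and `mate y` are the equally coloured ends, and the
    -- two halves of the block change roles.
    go (no ne) = ≤-trans (≤-reflexive (+-comm (weight x y + weight (mate x) (mate y)) _))
      (≤-trans (two-edges xx′ (adj-sym yy′) (trans (Boolₚ.¬-not ne) (sym (adj-colour (adj-sym yy′)))) x≢y′ mx≢y)
      (+-monoʳ-≤ 34 (*-monoʳ-≤ 22 (m≤m+n (a x y + a (mate x) (mate y)) _))))

  ¬loop : ∀ {z} → ¬ Adj G z z
  ¬loop zz = adj⇒≢ zz refl

  -- The coefficient of D is chosen to give equality on coinciding pieces: here 48 + 30 + 16 = 50 +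
  -- 22 · 2.
  matched-self : ∀ {x y} → mate x ≢ x → y ≡ x ⊎ y ≡ mate x → Shape (block weight x y) (D x y) (block a x y) 1 1
  matched-self {x} mx (inj₁ refl) = subst₂ (λ F A → Shape F (D x x) A 1 1) (sym F≡) (sym A≡)
    (subst (λ d → Shape 48 d 2 1 1) (sym (cong₂ _+_ (δ-refl x) (δ-≢ mx))) ≤-refl)
    where
    F≡ : block weight x x ≡ 48
    F≡ = cong₂ _+_ (cong₂ _+_ (weight-diag x) (weight-diag (mate x)))
      (cong₂ _+_ (weight-adj (mate-adj mx)) (weight-adj (adj-sym (mate-adj mx))))
    A≡ : block a x x ≡ 2
    A≡ = cong₂ _+_ (cong₂ _+_ (a-nonadj ¬loop) (a-nonadj ¬loop))
      (cong₂ _+_ (a-adj (mate-adj mx)) (a-adj (adj-sym (mate-adj mx))))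
  matched-self {x} mx (inj₂ refl) = subst₂ (λ F A → Shape F (D x (mate x)) A 1 1) (sym F≡) (sym A≡)
    (subst (λ d → Shape 48 d 2 1 1) (sym (cong₂ _+_ (δ-≢ (≢-sym mx)) (δ-refl (mate x)))) ≤-refl)
    where
    x″ = involutive x
    F≡ : block weight x (mate x) ≡ 48
    F≡ = cong₂ _+_ (cong₂ _+_ (weight-adj (mate-adj mx)) (trans (cong (weight (mate x)) x″) (weight-adj (adj-sym (mate-adj mx)))))
      (cong₂ _+_ (trans (cong (weight x) x″) (weight-diag x)) (weight-diag (mate x)))
    A≡ : block a x (mate x) ≡ 2
    A≡ = cong₂ _+_ (cong₂ _+_ (a-adj (mate-adj mx)) (trans (cong (a (mate x)) x″) (a-adj (adj-sym (mate-adj mx)))))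
      (cong₂ _+_ (trans (cong (a x) x″) (a-nonadj ¬loop)) (a-nonadj ¬loop))

  unmatched-matched : ∀ {x y} → mate x ≡ x → mate y ≢ y → block weight x y ≤ 40 + 16 * block a x y
  unmatched-matched {x} {y} mx my = subst₂ (λ F A → F ≤ 40 + 16 * A) (sym (B weight)) (sym (B a)) (twice {t = a x y + a x (mate y)} (vertex-edge {x} {y} {mate y} (mate-adj my)))
    where
    B : ∀ f → block f x y ≡ 2 * (f x y + f x (mate y))
    B f = trans (cong₂ (λ u v → f x y + u + (f x (mate y) + v)) (cong (λ z → f z (mate y)) mx) (cong (λ z → f z y) mx))
      (double (f x y) (f x (mate y)))

  matched-unmatched : ∀ {x y} → mate x ≢ x → mate y ≡ y → block weight x y ≤ 40 + 16 * block a x y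
  matched-unmatched {x} {y} mx my = subst₂ (λ F A → F ≤ 40 + 16 * A) (sym (B weight weight-sym)) (sym (B a a-sym)) (twice {t = a y x + a y (mate x)} (vertex-edge {y} {x} {mate x} (mate-adj mx)))
    where
    B : ∀ f → (∀ u v → f u v ≡ f v u) → block f x y ≡ 2 * (f y x + f y (mate x))
    B f f-sym = trans (cong₂ _+_
      (cong₂ _+_ (f-sym x y) (trans (cong (f (mate x)) my) (f-sym (mate x) y)))
      (cong₂ _+_ (trans (cong (f x) my) (f-sym x y)) (f-sym (mate x) y)))
      (double′ (f y x) (f y (mate x)))

  unmatched-unmatched : ∀ {x y} → mate x ≡ x → mate y ≡ y → block weight x y ≤ 48
  unmatched-unmatched {x} {y} mx my = subst (_≤ 48) (sym (cong₂ (λ u v → (weight x y + weight u v) + (weight x v + weight u y)) mx my))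
    (+-mono-≤ (+-mono-≤ w w) (+-mono-≤ w w))
    where w = weight-nonadj (independent mx my)

  -- D is 2, since both x and its mate coincide with x, and 2 · 24 makes up for the four vanishing
  -- weights, which are allowed 48.
  unmatched-self : ∀ {x} → mate x ≡ x → Shape (block weight x x) (D x x) (block a x x) 0 0
  unmatched-self {x} mx = subst₂ (λ F d → Shape F d (block a x x) 0 0) (sym F≡)
    (sym (cong₂ _+_ (δ-refl x) (trans (cong (λ z → δ z x) mx) (δ-refl x)))) (m≤m+n 48 _)
    where
    F≡ : block weight x x ≡ 0
    F≡ = trans (cong (λ u → (weight x x + weight u u) + (weight x u + weight u x)) mx)
      (cong (λ w → (w + w) + (w + w)) (weight-diag x))

  block-bound : ∀ x y → Shape (block weight x y) (D x y) (block a x y) (μ x) (μ y)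
  block-bound x y = go (mate x ≟ x) (mate y ≟ y) (x ≟ y) (mate x ≟ y)
    where
    Goal : Set
    Goal = Shape (block weight x y) (D x y) (block a x y) (μ x) (μ y)
    set : ∀ {i j} → μ x ≡ i → μ y ≡ j → Shape (block weight x y) (D x y) (block a x y) i j → Goal
    set refl refl sh = sh
    set₀ : ∀ {i j} → μ x ≡ i → μ y ≡ j → x ≢ y → mate x ≢ y → Shape (block weight x y) 0 (block a x y) i j → Goal
    set₀ {i} {j} p q u v sh = set p q (subst (λ d → Shape (block weight x y) d (block a x y) i j) (sym (D-≢ u v)) sh)
    F = block weight x y
    A = block a x y
    go : Dec (mate x ≡ x) → Dec (mate y ≡ y) → Dec (x ≡ y) → Dec (mate x ≡ y) → Goal
    go (yes mx) (yes my) (yes refl) _ = set (moved-≡ mate mx) (moved-≡ mate my) (unmatched-self mx)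
    go (yes mx) (yes my) (no x≢y) _ = set₀ (moved-≡ mate mx) (moved-≡ mate my) x≢y (λ eq → x≢y (trans (sym mx) eq))
      (shape₀₀ {F} {A} (unmatched-unmatched mx my))
    go (yes mx) (no my) _ _ = set₀ (moved-≡ mate mx) (moved-≢ mate my) (λ { refl → my mx }) (λ eq → my (subst (λ z → mate z ≡ z) (trans (sym mx) eq) mx))
      (shape₀₁ {F} {A} (unmatched-matched mx my))
    go (no mx) (yes my) _ _ = set₀ (moved-≢ mate mx) (moved-≡ mate my) (λ { refl → mx my }) (λ eq → mx (mate-injective (trans (cong mate eq) (trans my (sym eq)))))
      (shape₁₀ {F} {A} (matched-unmatched mx my))
    go (no mx) (no my) (yes eq) _ = set (moved-≢ mate mx) (moved-≢ mate my) (matched-self mx (inj₁ (sym eq)))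
    go (no mx) (no my) _ (yes eq) = set (moved-≢ mate mx) (moved-≢ mate my) (matched-self mx (inj₂ (sym eq)))
    go (no mx) (no my) (no u) (no v) = set₀ (moved-≢ mate mx) (moved-≢ mate my) u v
      (shape₁₁ {F} {A} (matched-matched mx my u v))

-- Summation over all pairs of pieces

module Counting (G : Graph n) (tree : IsTree G) (r : Fin n) {β : ℕ} (M : Mating G β)
  (independent : ∀ {x y} → Mating.mate M x ≡ x → Mating.mate M y ≡ y → ¬ Adj G x y)
  (root-matched : Mating.mate M r ≢ r) where

  open RootedTree G tree r
  open Weight G tree r
  open Mating M
  open Pieces G tree r M independent

  μ-mate : ∀ x → μ (mate x) ≡ μ x
  μ-mate x = go (mate x ≟ x)
    where
    go : Dec (mate x ≡ x) → μ (mate x) ≡ μ x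
    go (yes eq) = cong μ eq
    go (no ne)  = trans (moved-≢ mate (λ eq → ne (mate-injective eq))) (sym (moved-≢ mate ne))

  μ≤1 : ∀ x → μ x ≤ 1
  μ≤1 x = go (mate x ≟ x)
    where
    go : Dec (mate x ≡ x) → μ x ≤ 1
    go (yes eq) = ≤-trans (≤-reflexive (moved-≡ mate eq)) z≤n
    go (no ne)  = ≤-reflexive (moved-≢ mate ne)

  block-sum : ∀ f → ∑∑ (block f) ≡ 4 * ∑∑ f
  block-sum f = begin
    ∑∑ (block f)                                    ≡⟨ trans (∑∑-+ {n} _ _) (cong₂ _+_ (∑∑-+ f _) (∑∑-+ {n} _ _)) ⟩
    (∑∑ f + ∑∑ (λ x y → f (mate x) (mate y))) + (∑∑ (λ x y → f x (mate y)) + ∑∑ (λ x y → f (mate x) y))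
                                                    ≡⟨ cong₂ _+_ (cong (∑∑ f +_) (trans (right (λ x → f (mate x))) (left f))) (cong₂ _+_ (right f) (left f)) ⟩
    (∑∑ f + ∑∑ f) + (∑∑ f + ∑∑ f)                   ≡⟨ four (∑∑ f) ⟩
    4 * ∑∑ f                                        ∎
    where
    open ≡-Reasoning
    four : ∀ s → (s + s) + (s + s) ≡ 4 * s
    four = solve-∀
    left : ∀ f → ∑∑ (λ x y → f (mate x) y) ≡ ∑∑ f
    left f = sum-involution (λ x → sum (f x)) mate involutive
    right : ∀ f → ∑∑ (λ x y → f x (mate y)) ≡ ∑∑ f
    right f = sum-cong-≗ λ x → sum-involution (f x) mate involutive

  h : Fin n → Fin n → ℕ
  h x y = 10 + 6 * (μ x + μ y)

  h-sym : ∀ x y → h x y ≡ h y x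
  h-sym x y = cong (λ s → 10 + 6 * s) (+-comm (μ x) (μ y))

  -- Every edge joins exactly one non-root vertex to its parent; the root, being its own parent, is counted twice.
  adjacency : ∀ x y → a x y + 2 * (δ r x * δ r y) ≡ δ (par x) y + δ (par y) x
  adjacency x y = go (adj? x y) (r ≟ x) (r ≟ y)
    where
    value : ∀ {s t u v w} → a x y ≡ s → δ r x ≡ t → δ r y ≡ u → δ (par x) y ≡ v → δ (par y) x ≡ w →
      s + 2 * (t * u) ≡ v + w → a x y + 2 * (δ r x * δ r y) ≡ δ (par x) y + δ (par y) x
    value refl refl refl refl refl eq = eq
    δ-≡ : ∀ {i j : Fin n} → i ≡ j → δ i j ≡ 1
    δ-≡ {i} refl = δ-refl i
    antisym : ∀ {u v} → u ≢ r → par u ≡ v → par v ≢ u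
    antisym {u} {v} u≢r refl eq with par u ≟ r
    ... | yes pu≡r = u≢r (trans (sym eq) (trans (cong par pu≡r) par-root))
    ... | no  pu≢r = m≢1+m+n (depth u) {1} (trans (par-depth u≢r) (trans (cong suc (par-depth pu≢r))
      (trans (cong (λ z → suc (suc (depth z))) eq) (cong suc (+-comm 1 (depth u))))))
    skew : ∀ {u v} → ¬ Adj G u v → r ≢ u ⊎ r ≢ v → par u ≢ v
    skew {u} ¬uv side eq with u ≟ r
    ... | no u≢r = ¬uv (subst (Adj G u) eq (par-adj u≢r))
    skew ¬uv (inj₁ r≢u) eq | yes refl = r≢u refl
    skew ¬uv (inj₂ r≢v) eq | yes refl = r≢v (trans (sym par-root) eq)
    go : Dec (Adj G x y) → Dec (r ≡ x) → Dec (r ≡ y) → a x y + 2 * (δ r x * δ r y) ≡ δ (par x) y + δ (par y) x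
    go (yes xy) _ _ with adj-cases xy
    ... | inj₁ (x≢r , eq) = value {s = 1} {u = δ r y} (a-adj xy) (δ-≢ (≢-sym x≢r)) refl (δ-≡ eq) (δ-≢ (antisym x≢r eq)) refl
    ... | inj₂ (y≢r , eq) = value {s = 1} {t = δ r x} (a-adj xy) refl (δ-≢ (≢-sym y≢r)) (δ-≢ (antisym y≢r eq)) (δ-≡ eq)
        (cong (λ t → 1 + 2 * t) (*-zeroʳ (δ r x)))
    go (no ¬xy) (yes refl) (yes refl) = value {s = 0} (a-nonadj ¬xy) (δ-refl r) (δ-refl r) (δ-≡ par-root) (δ-≡ par-root) refl
    go (no ¬xy) (no r≢x) _ = value {s = 0} {u = δ r y} (a-nonadj ¬xy) (δ-≢ r≢x) refl
      (δ-≢ (skew ¬xy (inj₁ r≢x))) (δ-≢ (skew (λ yx → ¬xy (adj-sym yx)) (inj₂ r≢x))) refl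
    go (no ¬xy) (yes _) (no r≢y) = value {s = 0} {t = δ r x} (a-nonadj ¬xy) refl (δ-≢ r≢y)
      (δ-≢ (skew ¬xy (inj₂ r≢y))) (δ-≢ (skew (λ yx → ¬xy (adj-sym yx)) (inj₁ r≢y))) (cong (2 *_) (*-zeroʳ (δ r x)))

  -- P counts the vertices whose parent is matched. Together with n and β it determines Z.
  Z P S : ℕ
  Z = ∑∑ (λ x y → h x y * a x y)
  P = sum (λ x → μ (par x))
  S = ∑< weight

  linear : ∀ c d (f : Fin n → ℕ) → sum (λ x → c + d * f x) ≡ n * c + d * sum f
  linear c d f = trans (∑-distrib-+ (λ _ → c) (λ x → d * f x)) (cong₂ _+_ (sum-const n c) (sym (*-distribˡ-sum d f)))

  -- `adjacency` is summed with the symmetric factor h. The correction 44 is twice `h r r` = 22, the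
  -- value at a matched root; all other vertices contribute the edge to their parent, once in each
  -- direction.
  Z-value : Z + 44 ≡ 2 * (n * 10 + 6 * (2 * β + P))
  Z-value = begin
    Z + 44                                            ≡⟨ cong (Z +_) root ⟨
    Z + ∑∑ (λ x y → 2 * (δ r x * (δ r y * h x y)))    ≡⟨ ∑∑-+ {n} _ _ ⟨
    ∑∑ (λ x y → h x y * a x y + 2 * (δ r x * (δ r y * h x y)))  ≡⟨ ∑∑-cong {n} pt ⟩
    ∑∑ (λ x y → δ (par x) y * h x y + δ (par y) x * h y x)      ≡⟨ trans (∑∑-+ {n} _ _) (cong (K +_) (∑∑-flip (λ x y → δ (par x) y * h x y))) ⟩
    K + K                                             ≡⟨ cong (K +_) (+-identityʳ K) ⟨
    2 * K                                             ≡⟨ cong (2 *_) K-value ⟩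
    2 * (n * 10 + 6 * (2 * β + P))                    ∎
    where
    open ≡-Reasoning
    K = ∑∑ (λ x y → δ (par x) y * h x y)
    K-value : K ≡ n * 10 + 6 * (2 * β + P)
    K-value = trans (sum-cong-≗ {n} (λ x → sum-δ (par x) (h x))) (trans (linear 10 6 (λ x → μ x + μ (par x)))
      (cong (λ s → n * 10 + 6 * s) (trans (∑-distrib-+ μ (λ x → μ (par x))) (cong (_+ P) moved-sum))))
    root : ∑∑ (λ x y → 2 * (δ r x * (δ r y * h x y))) ≡ 44
    root = trans (∑∑-*ˡ {n} 2 _) (cong (2 *_) (begin
      ∑∑ (λ x y → δ r x * (δ r y * h x y))            ≡⟨ sum-cong-≗ {n} (λ x → trans (sym (*-distribˡ-sum (δ r x) (λ y → δ r y * h x y))) (cong (δ r x *_) (sum-δ r (h x)))) ⟩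
      sum (λ x → δ r x * h x r)                       ≡⟨ sum-δ r (λ x → h x r) ⟩
      h r r                                           ≡⟨ cong (λ i → 10 + 6 * (i + i)) (moved-≢ mate root-matched) ⟩
      22                                              ∎))
    pt : ∀ x y → h x y * a x y + 2 * (δ r x * (δ r y * h x y)) ≡ δ (par x) y * h x y + δ (par y) x * h y x
    pt x y = trans (collect (h x y) (a x y) (δ r x) (δ r y)) (trans (cong (_* h x y) (adjacency x y))
      (trans (*-distribʳ-+ (h x y) (δ (par x) y) _) (cong (λ s → δ (par x) y * h x y + δ (par y) x * s) (h-sym x y))))
      where
      collect : ∀ h a s t → h * a + 2 * (s * (t * h)) ≡ (a + 2 * (s * t)) * h
      collect = solve-∀

  private
    lhs rhs : Fin n → Fin n → ℕ
    lhs x y = block weight x y + D x y * (24 + 6 * μ x) + 8 * (μ x + μ y)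
    rhs x y = 48 + 2 * (μ x * μ y) + h x y * block a x y

  lhs-sum : ∑∑ lhs ≡ 8 * S + 48 * n + 24 * β + 32 * (n * β)
  lhs-sum = begin
    ∑∑ lhs ≡⟨ trans (∑∑-+ {n} _ _) (cong (_+ ∑∑ (λ x y → 8 * (μ x + μ y))) (∑∑-+ (block weight) _)) ⟩
    ∑∑ (block weight) + ∑∑ (λ x y → D x y * (24 + 6 * μ x)) + ∑∑ (λ x y → 8 * (μ x + μ y))
      ≡⟨ cong₂ _+_ (cong₂ _+_ (trans (block-sum weight) (cong (4 *_) (∑∑≡2∑< weight weight-sym weight-diag))) coincide) linked ⟩
    4 * (2 * S) + 2 * (n * 24 + 6 * (2 * β)) + 8 * (n * (2 * β) + n * (2 * β)) ≡⟨ identity S n β ⟩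
    8 * S + 48 * n + 24 * β + 32 * (n * β) ∎
    where
    open ≡-Reasoning
    identity : ∀ S n β → 4 * (2 * S) + 2 * (n * 24 + 6 * (2 * β)) + 8 * (n * (2 * β) + n * (2 * β)) ≡ 8 * S + 48 * n + 24 * β + 32 * (n * β)
    identity = solve-∀
    linked : ∑∑ (λ x y → 8 * (μ x + μ y)) ≡ 8 * (n * (2 * β) + n * (2 * β))
    linked = trans (∑∑-*ˡ 8 (λ x y → μ x + μ y)) (cong (8 *_) (trans (∑∑-+ (λ x y → μ x) (λ x y → μ y))
      (cong₂ _+_ (trans (∑∑-fst μ) (cong (n *_) moved-sum)) (trans (∑∑-snd {n} μ) (cong (n *_) moved-sum)))))
    coincide : ∑∑ (λ x y → D x y * (24 + 6 * μ x)) ≡ 2 * (n * 24 + 6 * (2 * β))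
    coincide = begin
      ∑∑ (λ x y → D x y * (24 + 6 * μ x))  ≡⟨ sum-cong-≗ {n} (λ x → trans (sym (*-distribʳ-sum (24 + 6 * μ x) (D x)))
          (cong (_* (24 + 6 * μ x)) (trans (∑-distrib-+ (δ x) (δ (mate x))) (cong₂ _+_ (sum-δ₁ x) (sum-δ₁ (mate x)))))) ⟩
      sum (λ x → 2 * (24 + 6 * μ x))       ≡⟨ *-distribˡ-sum 2 (λ x → 24 + 6 * μ x) ⟨
      2 * sum (λ x → 24 + 6 * μ x)         ≡⟨ cong (2 *_) (trans (linear 24 6 μ) (cong (λ s → n * 24 + 6 * s) moved-sum)) ⟩
      2 * (n * 24 + 6 * (2 * β))           ∎

  -- These are the positive and the negative part of 24 times the bound, kept apart so as to stay in
  -- ℕ.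
  X Y : ℕ
  X = 6 * n * n + β * β + 9 * β + 10 * n
  Y = 4 * β * n + 22

  -- The summand 176 = 4 · 44 completes 4 Z for `Z-value`; it is also 8 · 22, the constant term of 8
  -- Y.
  rhs-sum : ∑∑ rhs + 176 ≡ 8 * X + 24 * β + 48 * P
  rhs-sum = begin
    ∑∑ rhs + 176  ≡⟨ cong (_+ 176) (trans (∑∑-+ {n} _ _) (cong (_+ ∑∑ (λ x y → h x y * block a x y)) (∑∑-+ {n} (λ _ _ → 48) _))) ⟩
    ∑∑ {n} (λ _ _ → 48) + ∑∑ (λ x y → 2 * (μ x * μ y)) + ∑∑ (λ x y → h x y * block a x y) + 176
      ≡⟨ cong (_+ 176) (cong₂ _+_ (cong₂ _+_ (∑∑-const {n} 48) products) (trans (∑∑-cong {n} pull) (block-sum (λ x y → h x y * a x y)))) ⟩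
    n * (n * 48) + 2 * (2 * β * (2 * β)) + 4 * Z + 176    ≡⟨ group n β Z ⟩
    n * (n * 48) + 2 * (2 * β * (2 * β)) + 4 * (Z + 44)   ≡⟨ cong (λ z → n * (n * 48) + 2 * (2 * β * (2 * β)) + 4 * z) Z-value ⟩
    n * (n * 48) + 2 * (2 * β * (2 * β)) + 4 * (2 * (n * 10 + 6 * (2 * β + P))) ≡⟨ identity n β P ⟩
    8 * X + 24 * β + 48 * P ∎
    where
    open ≡-Reasoning
    group : ∀ n β Z → n * (n * 48) + 2 * (2 * β * (2 * β)) + 4 * Z + 176 ≡ n * (n * 48) + 2 * (2 * β * (2 * β)) + 4 * (Z + 44)
    group = solve-∀
    identity : ∀ n β P → n * (n * 48) + 2 * (2 * β * (2 * β)) + 4 * (2 * (n * 10 + 6 * (2 * β + P))) ≡ 8 * (6 * n * n + β * β + 9 * β + 10 * n) + 24 * β + 48 * P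
    identity = solve-∀
    products : ∑∑ (λ x y → 2 * (μ x * μ y)) ≡ 2 * (2 * β * (2 * β))
    products = trans (∑∑-*ˡ 2 (λ x y → μ x * μ y)) (cong (2 *_) (trans (∑∑-× μ μ) (cong₂ _*_ moved-sum moved-sum)))
    pull : ∀ x y → h x y * block a x y ≡ block (λ x y → h x y * a x y) x y
    pull x y = trans (expand (h x y) (a x y) (a (mate x) (mate y)) (a x (mate y)) (a (mate x) y))
      (cong₂ (λ s t → (h x y * a x y + s) + t)
        (cong (_* a (mate x) (mate y)) (cong₂ (λ i j → 10 + 6 * (i + j)) (sym (μ-mate x)) (sym (μ-mate y))))
        (cong₂ _+_ (cong (λ j → (10 + 6 * (μ x + j)) * a x (mate y)) (sym (μ-mate y)))
                   (cong (λ i → (10 + 6 * (i + μ y)) * a (mate x) y) (sym (μ-mate x)))))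
      where
      expand : ∀ h s t u v → h * ((s + t) + (u + v)) ≡ (h * s + h * t) + (h * u + h * v)
      expand = solve-∀

  -- Here the number of edges between matching edges is bounded. Equality says that every parent is
  -- matched, so that each unmatched vertex is a leaf.
  P≤n : P ≤ n
  P≤n = ≤-trans (sum-mono (λ x → μ≤1 (par x))) (≤-reflexive (trans (sum-const n 1) (*-identityʳ n)))

  lhs-value : ∑∑ lhs + 176 ≡ 8 * (S + Y) + 24 * β + 48 * n
  lhs-value = trans (cong (_+ 176) lhs-sum) (identity S n β)
    where
    identity : ∀ S n β → 8 * S + 48 * n + 24 * β + 32 * (n * β) + 176 ≡ 8 * (S + (4 * β * n + 22)) + 24 * β + 48 * n
    identity = solve-∀

  lhs≤rhs : 8 * (S + Y) + 24 * β + 48 * n ≤ 8 * X + 24 * β + 48 * P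
  lhs≤rhs = subst₂ _≤_ lhs-value rhs-sum (+-monoˡ-≤ 176 (∑∑-mono block-bound))

  weight-bound : S + Y ≤ X
  weight-bound = *-cancelˡ-≤ 8 (+-cancelʳ-≤ (24 * β + 48 * n) _ _ (begin
    8 * (S + Y) + (24 * β + 48 * n)  ≡⟨ +-assoc (8 * (S + Y)) (24 * β) (48 * n) ⟨
    8 * (S + Y) + 24 * β + 48 * n    ≤⟨ lhs≤rhs ⟩
    8 * X + 24 * β + 48 * P          ≤⟨ +-monoʳ-≤ (8 * X + 24 * β) (*-monoʳ-≤ 48 P≤n) ⟩
    8 * X + 24 * β + 48 * n          ≡⟨ +-assoc (8 * X) (24 * β) (48 * n) ⟩
    8 * X + (24 * β + 48 * n)        ∎))
    where open ≤-Reasoning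

  module Tight (tight : X ≤ S + Y) where

    parents-matched : ∀ x → mate (par x) ≢ par x
    parents-matched x eq = contradiction (trans (sym (moved-≡ mate eq)) (sum-tight (λ x → μ≤1 (par x)) n≤P x)) λ ()
      where
      open ≤-Reasoning
      n≤P : sum {n} (λ _ → 1) ≤ P
      n≤P = *-cancelˡ-≤ 48 (+-cancelˡ-≤ (8 * X + 24 * β) _ _ (begin
        8 * X + 24 * β + 48 * sum {n} (λ _ → 1)  ≡⟨ cong (λ s → 8 * X + 24 * β + 48 * s) (trans (sum-const n 1) (*-identityʳ n)) ⟩
        8 * X + 24 * β + 48 * n                  ≤⟨ +-monoˡ-≤ (48 * n) (+-monoˡ-≤ (24 * β) (*-monoʳ-≤ 8 tight)) ⟩
        8 * (S + Y) + 24 * β + 48 * n            ≤⟨ lhs≤rhs ⟩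
        8 * X + 24 * β + 48 * P                  ∎))

    block-tight : ∀ x y → lhs x y ≡ rhs x y
    block-tight = ∑∑-tight block-bound (+-cancelʳ-≤ 176 _ _ (begin
      ∑∑ rhs + 176                   ≡⟨ rhs-sum ⟩
      8 * X + 24 * β + 48 * P        ≤⟨ +-mono-≤ (+-monoˡ-≤ (24 * β) (*-monoʳ-≤ 8 tight)) (*-monoʳ-≤ 48 P≤n) ⟩
      8 * (S + Y) + 24 * β + 48 * n  ≡⟨ lhs-value ⟨
      ∑∑ lhs + 176                   ∎))
      where open ≤-Reasoning

    record Close (x y : Fin n) : Set where
      field
        p q : Fin n
        p∈  : p ≡ x ⊎ p ≡ mate x
        q∈  : q ≡ y ⊎ q ≡ mate y
        near : Adj G p q ⊎ Common p q

    -- Ends that are neither adjacent nor joined by a common neighbour weigh at most 8 a pair, so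
    -- pieces that are not close have a block of at most 32. Equality in `Shape` with A = 0 would
    -- demand 34, 40 or 48.
    pieces-close : ∀ {x y} → x ≢ y → mate x ≢ y → Close x y
    pieces-close {x} {y} x≢y mx≢y = go (near? x y) (near? (mate x) (mate y)) (near? x (mate y)) (near? (mate x) y)
      where
      near? : ∀ p q → (Adj G p q ⊎ Common p q) ⊎ (¬ Adj G p q × ¬ Common p q)
      near? p q with adj? p q | common? p q
      ... | yes e | _     = inj₁ (inj₁ e)
      ... | no _  | yes c = inj₁ (inj₂ c)
      ... | no ¬e | no ¬c = inj₂ (¬e , ¬c)
      F = block weight x y
      impossible : ∀ {i j} → i ≤ 1 → j ≤ 1 → F ≤ 32 →
        F + 0 * (24 + 6 * i) + 8 * (i + j) ≡ 48 + 2 * (i * j) + (10 + 6 * (i + j)) * 0 → ⊥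
      impossible {zero} {zero} _ _ F≤ eq = <⇒≱ {32} {48} (≤ᵇ⇒≤ 33 48 _) (≤-trans (≤-reflexive (sym eq)) (+-mono-≤ (+-mono-≤ F≤ ≤-refl) ≤-refl))
      impossible {zero} {suc zero} _ _ F≤ eq = <⇒≱ {40} {48} (≤ᵇ⇒≤ 41 48 _) (≤-trans (≤-reflexive (sym eq)) (+-mono-≤ (+-mono-≤ F≤ ≤-refl) ≤-refl))
      impossible {suc zero} {zero} _ _ F≤ eq = <⇒≱ {40} {48} (≤ᵇ⇒≤ 41 48 _) (≤-trans (≤-reflexive (sym eq)) (+-mono-≤ (+-mono-≤ F≤ ≤-refl) ≤-refl))
      impossible {suc zero} {suc zero} _ _ F≤ eq = <⇒≱ {48} {50} (≤ᵇ⇒≤ 49 50 _) (≤-trans (≤-reflexive (sym eq)) (+-mono-≤ (+-mono-≤ F≤ ≤-refl) ≤-refl))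
      impossible {suc (suc _)} (s≤s ()) _ _ _
      impossible {_} {suc (suc _)} _ (s≤s ()) _ _
      go : _ → _ → _ → _ → Close x y
      go (inj₁ e) _ _ _ = record { p∈ = inj₁ refl ; q∈ = inj₁ refl ; near = e }
      go _ (inj₁ e) _ _ = record { p∈ = inj₂ refl ; q∈ = inj₂ refl ; near = e }
      go _ _ (inj₁ e) _ = record { p∈ = inj₁ refl ; q∈ = inj₂ refl ; near = e }
      go _ _ _ (inj₁ e) = record { p∈ = inj₂ refl ; q∈ = inj₁ refl ; near = e }
      go (inj₂ (e₁ , c₁)) (inj₂ (e₂ , c₂)) (inj₂ (e₃ , c₃)) (inj₂ (e₄ , c₄)) = ⊥-elim (impossible (μ≤1 x) (μ≤1 y)
        (+-mono-≤ (+-mono-≤ (weight-far e₁ c₁) (weight-far e₂ c₂)) (+-mono-≤ (weight-far e₃ c₃) (weight-far e₄ c₄)))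
        (trans (cong (λ d → F + d * (24 + 6 * μ x) + 8 * (μ x + μ y)) (sym (D-≢ x≢y mx≢y)))
          (trans (block-tight x y) (cong (λ A → 48 + 2 * (μ x * μ y) + h x y * A)
            (cong₂ _+_ (cong₂ _+_ (a-nonadj e₁) (a-nonadj e₂)) (cong₂ _+_ (a-nonadj e₃) (a-nonadj e₄)))))))

-- The centre of an extremal tree

argmax : (f : Fin n → ℕ) → Fin n → ∃ λ t → ∀ x → f x ≤ f t
argmax {suc zero} f _ = zero , λ { zero → ≤-refl }
argmax {suc (suc n)} f _ with argmax (f ∘ suc) zero
... | t , t-max with ≤-total (f zero) (f (suc t))
...   | inj₁ le = suc t , λ { zero → le ; (suc x) → t-max x }
...   | inj₂ ge = zero , λ { zero → ≤-refl ; (suc x) → ≤-trans (t-max x) ge }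

injective⇒bijective : {f : Fin n → Fin n} → Injective _≡_ _≡_ f → Bijective _≡_ _≡_ f
injective⇒bijective {n} {f} f-inj = f-inj , surj n f f-inj
  where
  surj : ∀ n (f : Fin n → Fin n) → Injective _≡_ _≡_ f → Surjective _≡_ _≡_ f
  surj (suc n) f f-inj y with Finₚ.any? (λ x → f x ≟ y)
  ... | yes (x , eq) = x , λ { refl → eq }
  ... | no ∄x = contradiction (Finₚ.injective⇒≤ {f = λ x → punchOut {i = y} {j = f x} (λ eq → ∄x (x , sym eq))}
                  (λ {x} {z} eq → f-inj (Finₚ.punchOut-injective (λ e → ∄x (x , sym e)) (λ e → ∄x (z , sym e)) eq))) 1+n≰n

count : (Fin n → Bool) → ℕ
count P = sum (λ x → bit (P x))

rank : (Fin n → Bool) → Fin n → ℕ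
rank P zero    = 0
rank P (suc x) = bit (P zero) + rank (P ∘ suc) x

rank<count : (P : Fin n → Bool) → ∀ {x} → P x ≡ true → rank P x < count P
rank<count P {zero}  p rewrite p = s≤s z≤n
rank<count P {suc x} p = ≤-trans (≤-reflexive (sym (+-suc (bit (P zero)) _))) (+-monoʳ-≤ (bit (P zero)) (rank<count (P ∘ suc) p))

rank-injective : (P : Fin n → Bool) → ∀ {x y} → P x ≡ true → P y ≡ true → rank P x ≡ rank P y → x ≡ y
rank-injective P {zero}  {zero}  p q eq = refl
rank-injective P {zero}  {suc y} p q eq rewrite p = contradiction eq λ ()
rank-injective P {suc x} {zero}  p q eq rewrite q = contradiction eq λ ()
rank-injective P {suc x} {suc y} p q eq = cong suc (rank-injective (P ∘ suc) p q (+-cancelˡ-≡ (bit (P zero)) _ _ eq))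

-- This determines the tree: each matching edge away from the centre hangs on it by one end, and
-- parity and the absence of 4-cycles rule out further edges.
record Spurlike (G : Graph n) {β : ℕ} (M : Mating G β) : Set where
  open Mating M
  field
    centre         : Fin n
    centre-matched : mate centre ≢ centre
    spoke          : ∀ {y} → y ≢ centre → mate y ≢ centre → Adj G centre y ⊎ Adj G centre (mate y)

module Extremal (G : Graph n) (tree : IsTree G) (r : Fin n) {β : ℕ} (M : Mating G β)
  (independent : ∀ {x y} → Mating.mate M x ≡ x → Mating.mate M y ≡ y → ¬ Adj G x y)
  (root-matched : Mating.mate M r ≢ r) where

  open RootedTree G tree r
  open Weight G tree r
  open Mating M
  open Counting G tree r M independent root-matched

  module _ (tight : X ≤ S + Y) where
    open Tight tight

    -- The parent of the piece whose top is deepest: by closeness every other piece is adjacent to it.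
    spurlike : Spurlike G M
    spurlike = record { centre = v ; centre-matched = parents-matched t ; spoke = spoke }
      where
      -- A vertex hanging below its own mate is not the top of its piece and scores 0. The successor
      -- lets every top win against it, even the root, whose depth is 0.
      scoreOf : ∀ {x} → Dec (par x ≡ mate x) → ℕ
      scoreOf (yes _)    = 0
      scoreOf {x} (no _) = suc (depth x)

      score : Fin n → ℕ
      score x = scoreOf (par x ≟ mate x)

      score-top : ∀ {x} → par x ≢ mate x → score x ≡ suc (depth x)
      score-top {x} ne = go (par x ≟ mate x)
        where
        go : (d : Dec (par x ≡ mate x)) → scoreOf d ≡ suc (depth x)
        go (yes eq) = contradiction eq ne
        go (no _)   = refl

      t : Fin n
      t = proj₁ (argmax score r)

      t-max : ∀ x → score x ≤ score t
      t-max = proj₂ (argmax score r)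

      v : Fin n
      v = par t

      t-top : par t ≢ mate t
      t-top = go (par t ≟ mate t) (t-max r)
        where
        go : (d : Dec (par t ≡ mate t)) → score r ≤ scoreOf d → par t ≢ mate t
        go (yes _) le eq = 1+n≰n (≤-trans (≤-trans (s≤s z≤n) (≤-reflexive (sym (score-top root-top)))) le)
          where
          root-top : par r ≢ mate r
          root-top eq = root-matched (trans (sym eq) par-root)
        go (no ne) _ = ne

      deep : ∀ {x} → depth t < depth x → par x ≡ mate x
      deep {x} lt = go (par x ≟ mate x)
        where
        go : Dec (par x ≡ mate x) → par x ≡ mate x
        go (yes eq) = eq
        go (no ne)  = contradiction (≤-trans (≤-reflexive (sym (score-top ne)))
          (≤-trans (t-max x) (≤-reflexive (score-top t-top)))) (<⇒≱ (s≤s lt))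

      mate-below : mate t ≡ t ⊎ (mate t ≢ r × par (mate t) ≡ t)
      mate-below with mate t ≟ t
      ... | yes eq = inj₁ eq
      ... | no ne with adj-cases (mate-adj ne)
      ...   | inj₁ (_ , eq) = contradiction eq t-top
      ...   | inj₂ below    = inj₂ below

      depth-mate : depth t ≤ depth (mate t)
      depth-mate with mate-below
      ... | inj₁ eq          = ≤-reflexive (cong depth (sym eq))
      ... | inj₂ (≢r , eq) = ≤-trans (n≤1+n _) (≤-reflexive (sym (trans (par-depth ≢r) (cong (suc ∘ depth) eq))))

      data Near (q : Fin n) : Set where
        is-t    : q ≡ t → Near q
        is-mate : q ≡ mate t → Near q
        is-v    : q ≡ v → Near q

      -- The piece of t can be left only through v: a child of t or of its mate is deeper than t,
      -- hence by `deep` it hangs below its own mate and belongs to the piece.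
      neighbours : ∀ {p q} → p ≡ t ⊎ p ≡ mate t → Adj G q p → Near q
      neighbours {p} {q} p∈ qp = go p∈ (adj-cases qp)
        where
        child : depth t ≤ depth p → q ≢ r → par q ≡ p → mate q ≡ p
        child le q≢r eq = trans (sym (deep (≤-trans (s≤s le) (≤-reflexive (sym (trans (par-depth q≢r) (cong (suc ∘ depth) eq))))))) eq
        go : p ≡ t ⊎ p ≡ mate t → (q ≢ r × par q ≡ p) ⊎ (p ≢ r × par p ≡ q) → Near q
        go (inj₁ refl) (inj₁ (q≢r , eq)) = is-mate (trans (sym (involutive q)) (cong mate (child ≤-refl q≢r eq)))
        go (inj₂ refl) (inj₁ (q≢r , eq)) = is-t (mate-injective (child depth-mate q≢r eq))
        go (inj₁ refl) (inj₂ (_ , eq)) = is-v (sym eq)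
        go (inj₂ refl) (inj₂ (_ , eq)) with mate-below
        ... | inj₁ mt       = is-v (trans (sym eq) (cong par mt))
        ... | inj₂ (_ , pt) = is-t (trans (sym eq) pt)

      t-spoke : t ≢ v → Adj G v t
      t-spoke t≢v with t ≟ r
      ... | yes t≡r = contradiction (trans t≡r (trans (sym par-root) (cong par (sym t≡r)))) t≢v
      ... | no t≢r   = adj-sym (par-adj t≢r)

      spoke : ∀ {y} → y ≢ v → mate y ≢ v → Adj G v y ⊎ Adj G v (mate y)
      spoke {y} y≢v my≢v = go (t ≟ y) (mate t ≟ y)
        where
        go : Dec (t ≡ y) → Dec (mate t ≡ y) → Adj G v y ⊎ Adj G v (mate y)
        go (yes refl) _ = inj₁ (t-spoke y≢v)
        go (no _) (yes refl) = inj₂ (subst (Adj G v) (sym (involutive t)) (t-spoke λ eq → my≢v (trans (involutive t) eq)))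
        go (no t≢y) (no mt≢y) = near-case (Close.near c)
          where
          c = pieces-close t≢y mt≢y
          p = Close.p c
          q = Close.q c
          q≢t : q ≢ t
          q≢t eq with Close.q∈ c
          ... | inj₁ q≡y  = t≢y (trans (sym eq) q≡y)
          ... | inj₂ q≡my = mt≢y (trans (cong mate (trans (sym eq) q≡my)) (involutive y))
          q≢mt : q ≢ mate t
          q≢mt eq with Close.q∈ c
          ... | inj₁ q≡y  = mt≢y (trans (sym eq) q≡y)
          ... | inj₂ q≡my = t≢y (mate-injective (trans (sym eq) q≡my))
          q≢v : q ≢ v
          q≢v eq with Close.q∈ c
          ... | inj₁ q≡y  = y≢v (trans (sym q≡y) eq)
          ... | inj₂ q≡my = my≢v (trans (sym q≡my) eq)
          outside : ∀ {w} → w ≡ t ⊎ w ≡ mate t → ¬ Adj G q w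
          outside w∈ qw with neighbours w∈ qw
          ... | is-t eq    = q≢t eq
          ... | is-mate eq = q≢mt eq
          ... | is-v eq    = q≢v eq
          vq : Adj G v q → Adj G v y ⊎ Adj G v (mate y)
          vq e with Close.q∈ c
          ... | inj₁ q≡y  = inj₁ (subst (Adj G v) q≡y e)
          ... | inj₂ q≡my = inj₂ (subst (Adj G v) q≡my e)
          near-case : Adj G p q ⊎ Common p q → Adj G v y ⊎ Adj G v (mate y)
          near-case (inj₁ pq) = contradiction (adj-sym pq) (outside (Close.p∈ c))
          -- The common neighbour z is next to the piece of t. If it belonged to the piece, q would
          -- be next to the piece as well, against `outside`; so z is v.
          near-case (inj₂ (z , pz , zq)) with neighbours (Close.p∈ c) (adj-sym pz)
          ... | is-t eq    = contradiction (adj-sym zq) (outside (inj₁ eq))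
          ... | is-mate eq = contradiction (adj-sym zq) (outside (inj₂ eq))
          ... | is-v eq    = vq (subst (λ w → Adj G w q) eq zq)

-- The isomorphism with the spur

spurArc⁻ : ∀ m i j → spurArc m i j ≡ true → (i ≡ 0 × 1 ≤ j × j ≤ m) ⊎ (1 ≤ i × j ≡ i + m)
spurArc⁻ m i j eq with Equivalence.to (Boolₚ.T-∨ {(i ≡ᵇ 0) ∧ (1 ≤ᵇ j) ∧ (j ≤ᵇ m)}) (true⇒T eq)
... | inj₁ t = let p , t′ = Equivalence.to (Boolₚ.T-∧ {i ≡ᵇ 0}) t
                   q , s  = Equivalence.to (Boolₚ.T-∧ {1 ≤ᵇ j}) t′
               in inj₁ (≡ᵇ⇒≡ i 0 p , ≤ᵇ⇒≤ 1 j q , ≤ᵇ⇒≤ j m s)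
... | inj₂ t = let p , q = Equivalence.to (Boolₚ.T-∧ {1 ≤ᵇ i}) t in inj₂ (≤ᵇ⇒≤ 1 i p , ≡ᵇ⇒≡ j (i + m) q)

spurArc⁺ : ∀ m i j → (i ≡ 0 × 1 ≤ j × j ≤ m) ⊎ (1 ≤ i × j ≡ i + m) → spurArc m i j ≡ true
spurArc⁺ m i j (inj₁ (p , q , s)) = T⇒true (Equivalence.from (Boolₚ.T-∨ {(i ≡ᵇ 0) ∧ (1 ≤ᵇ j) ∧ (j ≤ᵇ m)})
  (inj₁ (Equivalence.from Boolₚ.T-∧ (≡⇒≡ᵇ i 0 p , Equivalence.from Boolₚ.T-∧ (≤⇒≤ᵇ q , ≤⇒≤ᵇ s)))))
spurArc⁺ m i j (inj₂ (p , q)) = T⇒true (Equivalence.from (Boolₚ.T-∨ {(i ≡ᵇ 0) ∧ (1 ≤ᵇ j) ∧ (j ≤ᵇ m)})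
  (inj₂ (Equivalence.from Boolₚ.T-∧ (≤⇒≤ᵇ p , ≡⇒≡ᵇ j (i + m) q))))

∨-true⁻ : ∀ {b c} → b ∨ c ≡ true → b ≡ true ⊎ c ≡ true
∨-true⁻ {true}  _  = inj₁ refl
∨-true⁻ {false} eq = inj₂ eq

∨-true⁺ : ∀ {b c} → b ≡ true ⊎ c ≡ true → b ∨ c ≡ true
∨-true⁺ (inj₁ refl) = refl
∨-true⁺ {b} (inj₂ refl) = Boolₚ.∨-zeroʳ b

bool-ext : ∀ {b c : Bool} → (b ≡ true → c ≡ true) → (c ≡ true → b ≡ true) → b ≡ c
bool-ext {true}  {_}     f g = sym (f refl)
bool-ext {false} {true}  f g = g refl
bool-ext {false} {false} f g = refl

module SpurIso (G : Graph n) (tree : IsTree G) {β : ℕ} (M : Mating G β) (spurlike : Spurlike G M) where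

  open Mating M
  open Spurlike spurlike renaming (centre to v)
  open RootedTree G tree v
  open Weight G tree v

  -- Outer vertices become the tips of the spur and inner ones the vertices that carry them. The
  -- rest are the other neighbours of v: its mate and the unmatched vertices.
  outer? inner? rest? : Fin n → Bool
  outer? y = not (does (y ≟ v)) ∧ not (G v y)
  inner? y = outer? (mate y)
  rest? y  = not (does (y ≟ v)) ∧ (not (outer? y) ∧ not (inner? y))

  outer⁻ : ∀ {y} → outer? y ≡ true → y ≢ v × ¬ Adj G v y
  outer⁻ {y} eq with y ≟ v | G v y
  ... | no ne | false = ne , λ ()

  outer⁺ : ∀ {y} → y ≢ v → ¬ Adj G v y → outer? y ≡ true
  outer⁺ {y} ne ¬e with y ≟ v | G v y
  ... | yes eq | _     = contradiction eq ne
  ... | no _   | true  = contradiction refl ¬e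
  ... | no _   | false = refl

  outer-mate : ∀ {y} → outer? y ≡ true → Adj G v (mate y)
  outer-mate {y} o = [ (λ e → contradiction e ¬vy) , id ]′ (spoke y≢v my≢v)
    where
    y≢v = proj₁ (outer⁻ o)
    ¬vy = proj₂ (outer⁻ o)
    my≢v : mate y ≢ v
    my≢v eq = ¬vy (subst (Adj G v) (trans (cong mate (sym eq)) (involutive y)) (mate-adj centre-matched))

  outer-moved : ∀ {y} → outer? y ≡ true → mate y ≢ y
  outer-moved {y} o eq = proj₂ (outer⁻ o) (subst (Adj G v) eq (outer-mate o))

  inner-adj : ∀ {y} → inner? y ≡ true → Adj G v y
  inner-adj {y} i = subst (Adj G v) (involutive y) (outer-mate i)

  not-outer : ∀ {x} → Adj G v x → outer? x ≡ false
  not-outer e = Boolₚ.¬-not λ o → proj₂ (outer⁻ o) e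

  not-inner : ∀ {x} → ¬ Adj G v x → inner? x ≡ false
  not-inner ¬e = Boolₚ.¬-not λ i → ¬e (inner-adj i)

  data Class (x : Fin n) : Set where
    is-centre : x ≡ v → Class x
    is-inner  : inner? x ≡ true → Class x
    is-rest   : rest? x ≡ true → Adj G v x → inner? x ≢ true → Class x
    is-outer  : outer? x ≡ true → Class x

  classify : ∀ x → Class x
  classify x with x ≟ v in eq | adj? v x | inner? x Boolₚ.≟ true
  ... | yes x≡v | _      | _      = is-centre x≡v
  ... | no x≢v  | no ¬vx | _      = is-outer (outer⁺ x≢v ¬vx)
  ... | no _    | yes _  | yes i  = is-inner i
  ... | no x≢v  | yes vx | no ¬i  = is-rest rest vx ¬i
    where
    rest : rest? x ≡ true
    rest rewrite eq | vx | Boolₚ.¬-not ¬i = refl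

  k ρ m : ℕ
  k = count outer?
  ρ = count rest?
  m = k + ρ

  -- The labels are 0 for the centre, 1 to k for inner, k + 1 to m for the rest, and m + 1 to m + k
  -- for outer vertices. Ranking an inner vertex by its mate makes the labels of a hanging edge
  -- differ by exactly m, as in `spurArc`.
  indexOf : ∀ {x} → Class x → ℕ
  indexOf {x} (is-centre _)   = 0
  indexOf {x} (is-inner _)    = 1 + rank outer? (mate x)
  indexOf {x} (is-rest _ _ _) = 1 + (k + rank rest? x)
  indexOf {x} (is-outer _)    = 1 + (m + rank outer? x)

  index : Fin n → ℕ
  index x = indexOf (classify x)

  private
    no-adj-v : ¬ Adj G v v
    no-adj-v e = adj⇒≢ e refl

    inner< : ∀ x → inner? x ≡ true → rank outer? (mate x) < k
    inner< x i = rank<count outer? {mate x} i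

    rest< : ∀ x → rest? x ≡ true → k + rank rest? x < m
    rest< x s = ≤-trans (≤-reflexive (sym (+-suc k _))) (+-monoʳ-≤ k (rank<count rest? {x} s))

    inner<m : ∀ x → inner? x ≡ true → rank outer? (mate x) < m
    inner<m x i = ≤-trans (inner< x i) (m≤m+n k ρ)

  indexOf-injective : ∀ {x y} (c : Class x) (d : Class y) → indexOf c ≡ indexOf d → x ≡ y
  indexOf-injective {x} {y} (is-centre p)    (is-centre q)    _  = trans p (sym q)
  indexOf-injective {x} {y} (is-inner p)     (is-inner q)     eq = mate-injective (rank-injective outer? {mate x} {mate y} p q (suc-injective eq))
  indexOf-injective {x} {y} (is-inner p)     (is-rest _ _ _)  eq = contradiction (suc-injective eq) (<⇒≢ (≤-trans (inner< x p) (m≤m+n k _)))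
  indexOf-injective {x} {y} (is-inner p)     (is-outer _)     eq = contradiction (suc-injective eq) (<⇒≢ (≤-trans (inner<m x p) (m≤m+n m _)))
  indexOf-injective {x} {y} (is-rest _ _ _)  (is-inner q)     eq = contradiction (sym (suc-injective eq)) (<⇒≢ (≤-trans (inner< y q) (m≤m+n k _)))
  indexOf-injective {x} {y} (is-rest p _ _)  (is-rest q _ _)  eq = rank-injective rest? {x} {y} p q (+-cancelˡ-≡ k _ _ (suc-injective eq))
  indexOf-injective {x} {y} (is-rest p _ _)  (is-outer _)     eq = contradiction (suc-injective eq) (<⇒≢ (≤-trans (rest< x p) (m≤m+n m _)))
  indexOf-injective {x} {y} (is-outer _)     (is-inner q)     eq = contradiction (sym (suc-injective eq)) (<⇒≢ (≤-trans (inner<m y q) (m≤m+n m _)))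
  indexOf-injective {x} {y} (is-outer _)     (is-rest q _ _)  eq = contradiction (sym (suc-injective eq)) (<⇒≢ (≤-trans (rest< y q) (m≤m+n m _)))
  indexOf-injective {x} {y} (is-outer p)     (is-outer q)     eq = rank-injective outer? {x} {y} p q (+-cancelˡ-≡ m _ _ (suc-injective eq))

  -- The four classes are disjoint, so `index` may be evaluated with any proof of membership.
  indexOf-unique : ∀ {x} (c d : Class x) → indexOf c ≡ indexOf d
  indexOf-unique (is-centre _)    (is-centre _)     = refl
  indexOf-unique (is-centre refl) (is-inner q)      = contradiction (inner-adj q) no-adj-v
  indexOf-unique (is-centre refl) (is-rest _ e _)   = contradiction e no-adj-v
  indexOf-unique (is-centre refl) (is-outer q)      = contradiction refl (proj₁ (outer⁻ q))
  indexOf-unique (is-inner p)     (is-centre refl)  = contradiction (inner-adj p) no-adj-v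
  indexOf-unique (is-inner _)     (is-inner _)      = refl
  indexOf-unique (is-inner p)     (is-rest _ _ ¬i)  = contradiction p ¬i
  indexOf-unique (is-inner p)     (is-outer q)      = contradiction (inner-adj p) (proj₂ (outer⁻ q))
  indexOf-unique (is-rest _ e _)  (is-centre refl)  = contradiction e no-adj-v
  indexOf-unique (is-rest _ _ ¬i) (is-inner q)      = contradiction q ¬i
  indexOf-unique (is-rest _ _ _)  (is-rest _ _ _)   = refl
  indexOf-unique (is-rest _ e _)  (is-outer q)      = contradiction e (proj₂ (outer⁻ q))
  indexOf-unique (is-outer p)     (is-centre refl)  = contradiction refl (proj₁ (outer⁻ p))
  indexOf-unique (is-outer p)     (is-inner q)      = contradiction (inner-adj q) (proj₂ (outer⁻ p))
  indexOf-unique (is-outer p)     (is-rest _ e _)   = contradiction e (proj₂ (outer⁻ p))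
  indexOf-unique (is-outer _)     (is-outer _)      = refl

  index≡ : ∀ {x} (c : Class x) → index x ≡ indexOf c
  index≡ {x} = indexOf-unique (classify x)

  index-injective : ∀ {x y} → index x ≡ index y → x ≡ y
  index-injective {x} {y} = indexOf-injective (classify x) (classify y)

  n≡ : n ≡ 1 + (m + k)
  n≡ = begin
    n                                   ≡⟨ trans (sum-const n 1) (*-identityʳ n) ⟨
    sum {n} (λ _ → 1)                   ≡⟨ sum-cong-≗ {n} (λ x → sym (one x)) ⟩
    sum (λ x → δ v x + ((bit (inner? x) + bit (rest? x)) + bit (outer? x)))
      ≡⟨ trans (∑-distrib-+ (δ v) _) (cong₂ _+_ (sum-δ₁ v) (trans (∑-distrib-+ (λ x → bit (inner? x) + bit (rest? x)) (λ x → bit (outer? x)))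
          (cong (_+ k) (trans (∑-distrib-+ (λ x → bit (inner? x)) (λ x → bit (rest? x))) (cong (_+ ρ) (sum-involution (λ x → bit (outer? x)) mate involutive)))))) ⟩
    1 + (m + k)                         ∎
    where
    open ≡-Reasoning
    values : ∀ {x s t u w} → δ v x ≡ s → inner? x ≡ t → rest? x ≡ u → outer? x ≡ w → s + ((bit t + bit u) + bit w) ≡ 1 →
      δ v x + ((bit (inner? x) + bit (rest? x)) + bit (outer? x)) ≡ 1
    values refl refl refl refl eq = eq
    rest-inner : ∀ {x} → inner? x ≡ true → rest? x ≡ false
    rest-inner {x} i rewrite i = trans (cong (not (does (x ≟ v)) ∧_) (Boolₚ.∧-zeroʳ (not (outer? x)))) (Boolₚ.∧-zeroʳ _)
    rest-outer : ∀ {x} → outer? x ≡ true → rest? x ≡ false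
    rest-outer {x} o rewrite o = Boolₚ.∧-zeroʳ _
    rest-centre : rest? v ≡ false
    rest-centre with v ≟ v
    ... | yes _ = refl
    ... | no ne = contradiction refl ne
    one : ∀ x → δ v x + ((bit (inner? x) + bit (rest? x)) + bit (outer? x)) ≡ 1
    one x with classify x
    ... | is-centre refl = values (δ-refl v) (not-inner no-adj-v) rest-centre (Boolₚ.¬-not λ o → proj₁ (outer⁻ o) refl) refl
    ... | is-inner i     = values (δ-≢ (adj⇒≢ (inner-adj i))) i (rest-inner i) (not-outer (inner-adj i)) refl
    ... | is-rest s e ¬i = values (δ-≢ (adj⇒≢ e)) (Boolₚ.¬-not ¬i) s (not-outer e) refl
    ... | is-outer o     = values (δ-≢ (≢-sym (proj₁ (outer⁻ o)))) (not-inner (proj₂ (outer⁻ o))) (rest-outer o) o refl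

  -- The matching consists of the edge at the centre and one edge for each outer vertex.
  β≡ : β ≡ 1 + k
  β≡ = *-cancelˡ-≡ β (1 + k) 2 (begin
    2 * β                      ≡⟨ moved-sum ⟨
    sum (moved mate)           ≡⟨ sum-cong-≗ {n} moved-split ⟩
    sum (λ y → (δ v y + δ (mate v) y) + (bit (outer? y) + bit (inner? y)))
      ≡⟨ trans (∑-distrib-+ (λ y → δ v y + δ (mate v) y) _) (cong₂ _+_ (trans (∑-distrib-+ (δ v) (δ (mate v))) (cong₂ _+_ (sum-δ₁ v) (sum-δ₁ (mate v))))
          (trans (∑-distrib-+ (λ y → bit (outer? y)) (λ y → bit (inner? y))) (cong (k +_) (sum-involution (λ x → bit (outer? x)) mate involutive)))) ⟩
    2 + (k + k)                ≡⟨ identity k ⟩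
    2 * (1 + k)                ∎)
    where
    open ≡-Reasoning
    identity : ∀ k → 2 + (k + k) ≡ 2 * (1 + k)
    identity = solve-∀
    values : ∀ {y s t u w z} → δ v y ≡ s → δ (mate v) y ≡ t → outer? y ≡ u → inner? y ≡ w → moved mate y ≡ z →
      z ≡ (s + t) + (bit u + bit w) → moved mate y ≡ (δ v y + δ (mate v) y) + (bit (outer? y) + bit (inner? y))
    values refl refl refl refl refl eq = eq
    v-mv : Adj G v (mate v)
    v-mv = mate-adj centre-matched
    moved-split : ∀ y → moved mate y ≡ (δ v y + δ (mate v) y) + (bit (outer? y) + bit (inner? y))
    moved-split y = split (y ≟ v) (y ≟ mate v)
      where
      split : Dec (y ≡ v) → Dec (y ≡ mate v) → moved mate y ≡ (δ v y + δ (mate v) y) + (bit (outer? y) + bit (inner? y))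
      split (yes refl) _ = values (δ-refl v) (δ-≢ centre-matched) (Boolₚ.¬-not λ o → proj₁ (outer⁻ o) refl)
          (not-inner no-adj-v) (moved-≢ mate centre-matched) refl
      split (no y≢v) (yes refl) = values (δ-≢ (≢-sym y≢v)) (δ-refl (mate v)) (not-outer v-mv)
          (Boolₚ.¬-not λ i → proj₁ (outer⁻ i) (involutive v)) (moved-≢ mate (λ eq → centre-matched (mate-injective eq))) refl
      split (no y≢v) (no y≢mv) = go (classify y) (mate y ≟ y)
        where
        my≢v : mate y ≢ v
        my≢v eq = y≢mv (trans (sym (involutive y)) (cong mate eq))
        δ₀ = δ-≢ (≢-sym y≢v)
        δ₁ = δ-≢ (≢-sym y≢mv)
        go : Class y → Dec (mate y ≡ y) → moved mate y ≡ (δ v y + δ (mate v) y) + (bit (outer? y) + bit (inner? y))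
        go (is-centre eq) _ = contradiction eq y≢v
        go (is-outer o) _ = values δ₀ δ₁ o (not-inner (proj₂ (outer⁻ o))) (moved-≢ mate (outer-moved o)) refl
        go (is-inner i) _ = values δ₀ δ₁ (not-outer (inner-adj i)) i
          (moved-≢ mate (λ eq → outer-moved i (cong mate eq))) refl
        go (is-rest _ e ¬i) (yes my) = values δ₀ δ₁ (not-outer e) (Boolₚ.¬-not ¬i) (moved-≡ mate my) refl
        -- A mate of y adjacent to v would form a triangle with y and v, against parity; a mate not
        -- adjacent to v is outer, which makes y inner.
        go (is-rest _ e ¬i) (no my) = contradiction (outer⁺ my≢v λ e′ →
          adj⇒colour≢ (mate-adj my) (walk₂-colour (adj-sym e) e′)) ¬i

  m≡ : m ≡ n ∸ β
  m≡ = sym (trans (cong₂ _∸_ (trans n≡ (sym (+-suc m k))) β≡) (m+n∸n≡m m (1 + k)))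

  Arc : Fin n → Fin n → Set
  Arc x y = (x ≡ v × Adj G v y) ⊎ (outer? y ≡ true × x ≡ mate y)

  spoke-range : ∀ {y} → Adj G v y → 1 ≤ index y × index y ≤ m
  spoke-range {y} e with classify y
  ... | is-centre refl = contradiction e no-adj-v
  ... | is-inner i     = s≤s z≤n , inner<m y i
  ... | is-rest s _ _  = s≤s z≤n , rest< y s
  ... | is-outer o     = contradiction e (proj₂ (outer⁻ o))

  index-outer : ∀ {y} → outer? y ≡ true → index y ≡ index (mate y) + m
  index-outer {y} o = trans (index≡ (is-outer o)) (trans (cong suc (+-comm m (rank outer? y)))
    (cong (_+ m) (sym (trans (index≡ (is-inner i)) (cong (suc ∘ rank outer?) (involutive y))))))
    where
    i : inner? (mate y) ≡ true
    i = trans (cong outer? (involutive y)) o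

  index-centre : index v ≡ 0
  index-centre = index≡ (is-centre refl)

  arc⁺ : ∀ {x y} → Arc x y → spurArc m (index x) (index y) ≡ true
  arc⁺ {x} {y} (inj₁ (refl , e)) = spurArc⁺ m (index x) (index y) (inj₁ (index-centre , spoke-range e))
  arc⁺ {x} {y} (inj₂ (o , refl)) = spurArc⁺ m (index x) (index y) (inj₂ (proj₁ (spoke-range (outer-mate o)) , index-outer o))

  arc⁻ : ∀ {x y} → spurArc m (index x) (index y) ≡ true → Arc x y
  arc⁻ {x} {y} eq = go (spurArc⁻ m (index x) (index y) eq) (classify y)
    where
    go : (index x ≡ 0 × 1 ≤ index y × index y ≤ m) ⊎ (1 ≤ index x × index y ≡ index x + m) → Class y → Arc x y
    go (inj₁ (p , q , _)) (is-centre refl) = contradiction (sym index-centre) (<⇒≢ q)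
    go (inj₁ (p , _ , _)) (is-inner i) = inj₁ (index-injective (trans p (sym index-centre)) , inner-adj i)
    go (inj₁ (p , _ , _)) (is-rest _ e _) = inj₁ (index-injective (trans p (sym index-centre)) , e)
    go (inj₁ (_ , _ , s)) (is-outer o) = contradiction (≤-trans (s≤s (m≤m+n m _)) (≤-trans (≤-reflexive (sym (index≡ (is-outer o)))) s)) 1+n≰n
    go (inj₂ (p , q)) (is-outer o) = inj₂ (o , index-injective (+-cancelʳ-≡ m _ _ (trans (sym q) (index-outer o))))
    go (inj₂ (p , q)) (is-centre refl) = contradiction (≤-trans (+-monoˡ-≤ m p) (≤-trans (≤-reflexive (trans (sym q) index-centre)) z≤n)) 1+n≰n
    go (inj₂ (p , q)) (is-inner i) = contradiction (≤-trans (+-monoˡ-≤ m p) (≤-trans (≤-reflexive (sym q)) (proj₂ (spoke-range (inner-adj i))))) 1+n≰n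
    go (inj₂ (p , q)) (is-rest _ e _) = contradiction (≤-trans (+-monoˡ-≤ m p) (≤-trans (≤-reflexive (sym q)) (proj₂ (spoke-range e)))) 1+n≰n

  outer-adj : ∀ {y} → outer? y ≡ true → Adj G (mate y) y
  outer-adj o = adj-sym (mate-adj (outer-moved o))

  arc⇒adj : ∀ {x y} → Arc x y → Adj G x y
  arc⇒adj (inj₁ (refl , e)) = e
  arc⇒adj (inj₂ (o , refl)) = outer-adj o

  -- Two neighbours of v have the same colour, and so do two outer vertices, so neither are
  -- adjacent. If a neighbour x of v other than `mate y` were adjacent to an outer y, then v, x, y,
  -- `mate y` would be a 4-cycle.
  adj⇒arc : ∀ {x y} → Adj G x y → Arc x y ⊎ Arc y x
  adj⇒arc {x} {y} e = go (x ≟ v) (y ≟ v) (adj? v x) (adj? v y)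
    where
    hang : ∀ {x y} → Adj G x y → Adj G v x → outer? y ≡ true → Arc x y
    hang {x} {y} xy vx o with x ≟ mate y
    ... | yes eq = inj₂ (o , eq)
    ... | no ne  = ⊥-elim (no-C₄ vx xy (adj-sym (outer-adj o)) (adj-sym (outer-mate o)) (≢-sym (proj₁ (outer⁻ o))) ne)
    go : Dec (x ≡ v) → Dec (y ≡ v) → Dec (Adj G v x) → Dec (Adj G v y) → Arc x y ⊎ Arc y x
    go (yes refl) _ _ _ = inj₁ (inj₁ (refl , e))
    go (no _) (yes refl) _ _ = inj₂ (inj₁ (refl , adj-sym e))
    go (no _) (no _) (yes vx) (yes vy) = contradiction (walk₂-colour (adj-sym vx) vy) (adj⇒colour≢ e)
    go (no _) (no y≢v) (yes vx) (no ¬vy) = inj₁ (hang e vx (outer⁺ y≢v ¬vy))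
    go (no x≢v) (no _) (no ¬vx) (yes vy) = inj₂ (hang (adj-sym e) vy (outer⁺ x≢v ¬vx))
    go (no x≢v) (no y≢v) (no ¬vx) (no ¬vy) = contradiction
      (trans (sym (walk₂-colour (outer-mate ox) (outer-adj ox))) (walk₂-colour (outer-mate oy) (outer-adj oy))) (adj⇒colour≢ e)
      where
      ox = outer⁺ x≢v ¬vx
      oy = outer⁺ y≢v ¬vy

  index<n : ∀ x → index x < n
  index<n x = ≤-trans (go (classify x)) (≤-reflexive (sym n≡))
    where
    go : (c : Class x) → indexOf c < 1 + (m + k)
    go (is-centre _)   = s≤s z≤n
    go (is-inner i)    = s≤s (≤-trans (inner<m x i) (m≤m+n m k))
    go (is-rest s _ _) = s≤s (≤-trans (rest< x s) (m≤m+n m k))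
    go (is-outer o)    = s≤s (≤-trans (≤-reflexive (sym (+-suc m _))) (+-monoʳ-≤ m (rank<count outer? {x} o)))

  iso : G ≅ spur n (n ∸ β)
  iso = f , injective⇒bijective f-injective , λ x y → subst (λ m → G x y ≡ spur n m (f x) (f y)) m≡ (edges x y)
    where
    f : Fin n → Fin n
    f x = fromℕ< (index<n x)
    toℕ-f : ∀ x → toℕ (f x) ≡ index x
    toℕ-f x = Finₚ.toℕ-fromℕ< (index<n x)
    f-injective : ∀ {x y} → f x ≡ f y → x ≡ y
    f-injective {x} {y} eq = index-injective (trans (sym (toℕ-f x)) (trans (cong toℕ eq) (toℕ-f y)))
    edges : ∀ x y → G x y ≡ spur n m (f x) (f y)
    edges x y = trans (bool-ext (λ e → ∨-true⁺ (map-⊎ arc⁺ arc⁺ (adj⇒arc e)))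
        (λ e → [ (λ s → arc⇒adj (arc⁻ s)) , (λ s → adj-sym (arc⇒adj (arc⁻ s))) ]′ (∨-true⁻ e)))
      (sym (cong₂ (λ i j → spurArc m i j ∨ spurArc m j i) (toℕ-f x) (toℕ-f y)))

-- The Harary index of the spur

sum-bijection : (g : Fin n → ℕ) {f : Fin n → Fin n} → Bijective _≡_ _≡_ f → sum (g ∘ f) ≡ sum g
sum-bijection g {f} (f-inj , f-surj) = sym (sum-permute g (Perm.permutation f (proj₁ ∘ f-surj)
  (λ y → proj₂ (f-surj y) refl) (λ x → f-inj (proj₂ (f-surj (f x)) refl))))

∑∑-bijection : (g : Fin n → Fin n → ℕ) {f : Fin n → Fin n} → Bijective _≡_ _≡_ f → ∑∑ (λ x y → g (f x) (f y)) ≡ ∑∑ g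
∑∑-bijection {n} g {f} bij = trans (sum-cong-≗ {n} λ x → sum-bijection (g (f x)) bij) (sum-bijection (λ i → sum (g i)) bij)

sum-< : ∀ n c → c ≤ n → sum {n} (λ i → bit (toℕ i <ᵇ c)) ≡ c
sum-< n       zero    _         = trans (sum-const n 0) (*-zeroʳ n)
sum-< (suc n) (suc c) (s≤s c≤n) = cong suc (sum-< n c c≤n)

inv≥ : ∀ {d w} s → 1 ≤ d → d ≤ s → w * s ≡ 24 → w /24 ℚ.≤ inv d
inv≥ {suc d} {w} s _ d≤s eq = /-mono w 23 1 d
  (≤-trans (*-monoʳ-≤ w d≤s) (≤-reflexive (trans eq (sym (+-identityʳ 24)))))

module _ {G : Graph n} where

  reach-weaken : ∀ {k x y} → Reach G k x y → Reach G (suc k) x y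
  reach-weaken {k} {x} {y} R = reached (∨-true⁺ {reach G k x y} (inj₁ (Reach.holds R)))

  reach-trans : ∀ {j k x y z} → Reach G j x y → Reach G k y z → Reach G (j + k) x z
  reach-trans {zero}  R R′ = subst (λ x → Reach G _ x _) (sym (reach-zero⁻ R)) R′
  reach-trans {suc j} R R′ with reach-suc⁻ R
  ... | inj₁ R″           = reach-weaken (reach-trans R″ R′)
  ... | inj₂ (w , a , R″) = reach-step a (reach-trans R″ R′)

  reach-adj : ∀ {x y} → Adj G x y → Reach G 1 x y
  reach-adj {x} {y} a = reach-step a (reach-refl G y)

-- Walks are pulled back from the spur to the tree, because only upper bounds on the distances in
-- the tree are wanted.
reach-≅ : {G H : Graph n} ((f , _) : G ≅ H) → ∀ {k x y} → Reach H k (f x) (f y) → Reach G k x y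
reach-≅ {G = G} (f , (f-inj , _) , _) {zero} {x} {y} R = subst (Reach G 0 x) (f-inj (reach-zero⁻ R)) (reach-refl G x)
reach-≅ {G = G} {H} G≅H@(f , (_ , f-surj) , edges) {suc k} {x} {y} R with reach-suc⁻ R
... | inj₁ R′ = reach-weaken (reach-≅ G≅H R′)
... | inj₂ (z , a , R′) = reach-step {z = x′}
    (trans (edges x x′) (subst (Adj H (f x)) (sym fx′) a)) (reach-≅ G≅H (subst (λ z → Reach H k z (f y)) (sym fx′) R′))
  where
  x′ = proj₁ (f-surj z)
  fx′ : f x′ ≡ z
  fx′ = proj₂ (f-surj z) refl

-- The levels are the distance classes of the spur around its centre, and `height` is the length of
-- the walk to the hub.
data Level : Set where
  hub mid tip : Level

height : Level → ℕ
height hub = 0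
height mid = 1
height tip = 2

isHub isMid isTip : Level → ℕ
isHub hub = 1
isHub _   = 0
isMid mid = 1
isMid _   = 0
isTip tip = 1
isTip _   = 0

-- 24 / (height + height), the weight of a pair joined through the hub
base : Level → Level → ℕ
base hub hub = 0
base hub mid = 24
base hub tip = 12
base mid hub = 24
base mid mid = 12
base mid tip = 8
base tip hub = 12
base tip mid = 8
base tip tip = 6

-- In this bilinear form the double sum of `base` factors into products of the level sizes 1, m and
-- k.
base-split : ∀ s t → base s t ≡ 24 * (isHub s * isMid t + isMid s * isHub t)
  + (12 * (isHub s * isTip t + isTip s * isHub t + isMid s * isMid t)
  + (8 * (isMid s * isTip t + isTip s * isMid t) + 6 * (isTip s * isTip t)))
base-split hub hub = refl
base-split hub mid = refl
base-split hub tip = refl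
base-split mid hub = refl
base-split mid mid = refl
base-split mid tip = refl
base-split tip hub = refl
base-split tip mid = refl
base-split tip tip = refl

base-sym : ∀ s t → base s t ≡ base t s
base-sym hub hub = refl
base-sym hub mid = refl
base-sym hub tip = refl
base-sym mid hub = refl
base-sym mid mid = refl
base-sym mid tip = refl
base-sym tip hub = refl
base-sym tip mid = refl
base-sym tip tip = refl

module LevelSums (lv : Fin n → Level) {m k : ℕ}
  (hubs : sum (λ i → isHub (lv i)) ≡ 1) (mids : sum (λ i → isMid (lv i)) ≡ m) (tips : sum (λ i → isTip (lv i)) ≡ k)
  (hang : Fin n → Fin n → Bool) (hang-count : k ≤ ∑∑ (λ i j → bit (hang i j))) (w : Fin n → Fin n → ℕ)
  (full-split : ∀ i j → base (lv i) (lv j) + 16 * (bit (hang i j) + bit (hang j i)) ≤ w i j + δ i j * (12 * isMid (lv j) + 6 * isTip (lv j))) where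

  base-sum : ∑∑ (λ i j → base (lv i) (lv j)) ≡ 24 * (1 * m + m * 1) + (12 * (1 * k + k * 1 + m * m) + (8 * (m * k + k * m) + 6 * (k * k)))
  base-sum = begin
    ∑∑ (λ i j → base (lv i) (lv j)) ≡⟨ ∑∑-cong {n} (λ i j → base-split (lv i) (lv j)) ⟩
    _ ≡⟨ trans (∑∑-+ {n} _ _) (cong₂ _+_ (trans (∑∑-*ˡ {n} 24 _) (cong (24 *_) (trans (∑∑-+ {n} _ _) (cong₂ _+_ (prod isHub isMid hubs mids) (prod isMid isHub mids hubs)))))
         (trans (∑∑-+ {n} _ _) (cong₂ _+_ (trans (∑∑-*ˡ {n} 12 _) (cong (12 *_) (trans (∑∑-+ {n} _ _) (cong₂ _+_ (trans (∑∑-+ {n} _ _) (cong₂ _+_ (prod isHub isTip hubs tips) (prod isTip isHub tips hubs))) (prod isMid isMid mids mids)))))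
         (trans (∑∑-+ {n} _ _) (cong₂ _+_ (trans (∑∑-*ˡ {n} 8 _) (cong (8 *_) (trans (∑∑-+ {n} _ _) (cong₂ _+_ (prod isMid isTip mids tips) (prod isTip isMid tips mids)))))
           (trans (∑∑-*ˡ {n} 6 _) (cong (6 *_) (prod isTip isTip tips tips)))))))) ⟩
    24 * (1 * m + m * 1) + (12 * (1 * k + k * 1 + m * m) + (8 * (m * k + k * m) + 6 * (k * k))) ∎
    where
    open ≡-Reasoning
    prod : ∀ (f g : Level → ℕ) {s t} → sum (λ i → f (lv i)) ≡ s → sum (λ i → g (lv i)) ≡ t → ∑∑ (λ i j → f (lv i) * g (lv j)) ≡ s * t
    prod f g p q = trans (∑∑-× (λ i → f (lv i)) (λ j → g (lv j))) (cong₂ _*_ p q)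

  -- `base` also counts the diagonal, 12 for each mid and 6 for each tip; this surplus is the
  -- `12 * m + 6 * k` on the right. The k hanging edges bring 16 in each direction.
  weight-sum : 24 * (1 * m + m * 1) + (12 * (1 * k + k * 1 + m * m) + (8 * (m * k + k * m) + 6 * (k * k))) + 16 * (k + k)
    ≤ ∑∑ w + (12 * m + 6 * k)
  weight-sum = begin
    24 * (1 * m + m * 1) + (12 * (1 * k + k * 1 + m * m) + (8 * (m * k + k * m) + 6 * (k * k))) + 16 * (k + k)
      ≤⟨ +-mono-≤ (≤-reflexive (sym base-sum)) (*-monoʳ-≤ 16 (+-mono-≤ hang-count (≤-trans hang-count (≤-reflexive (sym (∑∑-flip (λ i j → bit (hang i j)))))))) ⟩
    ∑∑ (λ i j → base (lv i) (lv j)) + 16 * (∑∑ (λ i j → bit (hang i j)) + ∑∑ (λ i j → bit (hang j i)))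
      ≡⟨ cong (∑∑ (λ i j → base (lv i) (lv j)) +_) (trans (cong (16 *_) (sym (∑∑-+ {n} _ _))) (sym (∑∑-*ˡ {n} 16 _))) ⟩
    ∑∑ (λ i j → base (lv i) (lv j)) + ∑∑ (λ i j → 16 * (bit (hang i j) + bit (hang j i)))  ≡⟨ ∑∑-+ {n} _ _ ⟨
    ∑∑ (λ i j → base (lv i) (lv j) + 16 * (bit (hang i j) + bit (hang j i))) ≤⟨ ∑∑-mono full-split ⟩
    ∑∑ (λ i j → w i j + δ i j * d j)          ≡⟨ ∑∑-+ w (λ i j → δ i j * d j) ⟩
    ∑∑ w + ∑∑ (λ i j → δ i j * d j)           ≡⟨ cong (∑∑ w +_) (begin-equality
      ∑∑ (λ i j → δ i j * d j)                           ≡⟨ sum-cong-≗ {n} (λ i → sum-δ i d) ⟩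
      sum d                                              ≡⟨ ∑-distrib-+ (λ j → 12 * isMid (lv j)) (λ j → 6 * isTip (lv j)) ⟩
      _                                                  ≡⟨ cong₂ _+_ (*-distribˡ-sum 12 (λ j → isMid (lv j))) (*-distribˡ-sum 6 (λ j → isTip (lv j))) ⟨
      _                                                  ≡⟨ cong₂ (λ s t → 12 * s + 6 * t) mids tips ⟩
      12 * m + 6 * k                                     ∎) ⟩
    ∑∑ w + (12 * m + 6 * k) ∎
    where
    open ≤-Reasoning
    d : Fin n → ℕ
    d j = 12 * isMid (lv j) + 6 * isTip (lv j)

module SpurWeight (m k N : ℕ) (k≤m : k ≤ m) (N≡ : N ≡ suc (m + k)) where

  A : Graph N
  A = spur N m

  level : ℕ → Level
  level i = if i <ᵇ 1 then hub else (if i <ᵇ suc m then mid else tip)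

  private
    <ᵇ-true : ∀ {i j} → i < j → (i <ᵇ j) ≡ true
    <ᵇ-true lt = T⇒true (<⇒<ᵇ lt)

    <ᵇ-false : ∀ {i j} → j ≤ i → (i <ᵇ j) ≡ false
    <ᵇ-false {i} {j} le = Boolₚ.¬-not λ eq → <⇒≱ (<ᵇ⇒< i j (true⇒T eq)) le

  level-mid : ∀ {i} → 1 ≤ i → i ≤ m → level i ≡ mid
  level-mid {suc i} _ i≤m rewrite <ᵇ-true (s≤s i≤m) = refl

  level-tip : ∀ {i} → m < i → level i ≡ tip
  level-tip {suc i} (s≤s m≤i) rewrite <ᵇ-false m≤i = refl

  data LevelView (i : ℕ) : Level → Set where
    at-hub : i ≡ 0 → LevelView i hub
    at-mid : 1 ≤ i → i ≤ m → LevelView i mid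
    at-tip : m < i → LevelView i tip

  levelView : ∀ i → LevelView i (level i)
  levelView zero = at-hub refl
  levelView (suc i) with i <ᵇ m in eq
  ... | true  = at-mid (s≤s z≤n) (<ᵇ⇒< i m (true⇒T eq))
  ... | false = at-tip (s≤s (≮⇒≥ λ lt → contradiction (trans (sym eq) (<ᵇ-true lt)) λ ()))

  lv : Fin N → Level
  lv i = level (toℕ i)

  private
    0<N : 0 < N
    0<N = subst (0 <_) (sym N≡) (s≤s z≤n)

    m<N : m < N
    m<N = subst (m <_) (sym N≡) (s≤s (m≤m+n m k))

  o : Fin N
  o = fromℕ< 0<N

  toℕ-o : toℕ o ≡ 0
  toℕ-o = Finₚ.toℕ-fromℕ< 0<N

  hubs : sum (λ i → isHub (lv i)) ≡ 1
  hubs = trans (sum-cong-≗ {N} λ i → pt (toℕ i)) (sum-< N 1 0<N)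
    where
    pt : ∀ i → isHub (level i) ≡ bit (i <ᵇ 1)
    pt zero = refl
    pt (suc i) with i <ᵇ m
    ... | true  = refl
    ... | false = refl

  mids : sum (λ i → isMid (lv i)) ≡ m
  mids = suc-injective (begin
    1 + sum (λ i → isMid (lv i))                    ≡⟨ cong (_+ sum (λ i → isMid (lv i))) hubs ⟨
    sum (λ i → isHub (lv i)) + sum (λ i → isMid (lv i)) ≡⟨ ∑-distrib-+ (λ i → isHub (lv i)) (λ i → isMid (lv i)) ⟨
    sum (λ i → isHub (lv i) + isMid (lv i))         ≡⟨ sum-cong-≗ {N} (λ i → pt (toℕ i)) ⟩
    sum {N} (λ i → bit (toℕ i <ᵇ suc m))            ≡⟨ sum-< N (suc m) m<N ⟩
    suc m                                           ∎)
    where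
    open ≡-Reasoning
    pt : ∀ i → isHub (level i) + isMid (level i) ≡ bit (i <ᵇ suc m)
    pt zero = refl
    pt (suc i) with i <ᵇ m
    ... | true  = refl
    ... | false = refl

  tips : sum (λ i → isTip (lv i)) ≡ k
  tips = +-cancelˡ-≡ (suc m) _ _ (begin
    suc m + sum (λ i → isTip (lv i))                ≡⟨ cong (_+ sum (λ i → isTip (lv i))) (sum-< N (suc m) m<N) ⟨
    sum {N} (λ i → bit (toℕ i <ᵇ suc m)) + sum (λ i → isTip (lv i)) ≡⟨ ∑-distrib-+ {N} (λ i → bit (toℕ i <ᵇ suc m)) (λ i → isTip (lv i)) ⟨
    sum {N} (λ i → bit (toℕ i <ᵇ suc m) + isTip (lv i)) ≡⟨ sum-cong-≗ {N} (λ i → pt (toℕ i)) ⟩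
    sum {N} (λ _ → 1)                               ≡⟨ trans (sum-const N 1) (trans (*-identityʳ N) N≡) ⟩
    suc m + k                                       ∎)
    where
    open ≡-Reasoning
    pt : ∀ i → bit (i <ᵇ suc m) + isTip (level i) ≡ 1
    pt zero = refl
    pt (suc i) with i <ᵇ m
    ... | true  = refl
    ... | false = refl

  hang : Fin N → Fin N → Bool
  hang i j = (1 ≤ᵇ toℕ i) ∧ (toℕ j ≡ᵇ toℕ i + m)

  hang⁻ : ∀ i j → hang i j ≡ true → 1 ≤ toℕ i × toℕ j ≡ toℕ i + m
  hang⁻ i j eq = let p , q = Equivalence.to (Boolₚ.T-∧ {1 ≤ᵇ toℕ i}) (true⇒T eq) in ≤ᵇ⇒≤ 1 (toℕ i) p , ≡ᵇ⇒≡ (toℕ j) (toℕ i + m) q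

  hang⁺ : ∀ i j → 1 ≤ toℕ i → toℕ j ≡ toℕ i + m → hang i j ≡ true
  hang⁺ i j p q = T⇒true (Equivalence.from Boolₚ.T-∧ (≤⇒≤ᵇ p , ≡⇒≡ᵇ (toℕ j) (toℕ i + m) q))

  hang-adj : ∀ i j → hang i j ≡ true → Adj A i j
  hang-adj i j eq = ∨-true⁺ {spurArc m (toℕ i) (toℕ j)} (inj₁ (spurArc⁺ m (toℕ i) (toℕ j) (inj₂ (hang⁻ i j eq))))

  adj-sym′ : ∀ i j → Adj A i j → Adj A j i
  adj-sym′ i j e = trans (Boolₚ.∨-comm (spurArc m (toℕ j) (toℕ i)) (spurArc m (toℕ i) (toℕ j))) e

  -- All labels are at most m + k, so i + m being a label forces i ≤ k, and `k ≤ m` places i among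
  -- the mids.
  hang-levels : ∀ i j → hang i j ≡ true → lv i ≡ mid × lv j ≡ tip
  hang-levels i j eq = level-mid 1≤i i≤m , level-tip (≤-trans (+-monoˡ-≤ m 1≤i) (≤-reflexive (sym j≡)))
    where
    1≤i = proj₁ (hang⁻ i j eq)
    j≡  = proj₂ (hang⁻ i j eq)
    i≤m : toℕ i ≤ m
    i≤m = ≤-trans (+-cancelʳ-≤ m _ _ (≤-trans (≤-reflexive (sym j≡)) (≤-trans (≤-pred (≤-trans (Finₚ.toℕ<n j) (≤-reflexive N≡))) (≤-reflexive (+-comm m k))))) k≤m

  adj-hub : ∀ j → lv j ≡ mid → Adj A o j
  adj-hub j eq = go (levelView (toℕ j)) eq
    where
    go : ∀ {s} → LevelView (toℕ j) s → s ≡ mid → Adj A o j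
    go (at-mid p q) _ = ∨-true⁺ {spurArc m (toℕ o) (toℕ j)} (inj₁ (spurArc⁺ m (toℕ o) (toℕ j) (inj₁ (toℕ-o , p , q))))

  attach : ∀ j → lv j ≡ tip → ∃ λ i → hang i j ≡ true
  attach j eq = go (levelView (toℕ j)) eq
    where
    lt : toℕ j ∸ m < N
    lt = ≤-trans (s≤s (m∸n≤m (toℕ j) m)) (Finₚ.toℕ<n j)
    i : Fin N
    i = fromℕ< lt
    i≡ : toℕ i ≡ toℕ j ∸ m
    i≡ = Finₚ.toℕ-fromℕ< lt
    go : ∀ {s} → LevelView (toℕ j) s → s ≡ tip → ∃ λ i → hang i j ≡ true
    go (at-tip m<j) _ = i , hang⁺ i j (≤-trans (m<n⇒0<n∸m m<j) (≤-reflexive (sym i≡)))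
      (sym (trans (cong (_+ m) i≡) (m∸n+n≡m (<⇒≤ m<j))))

  hub-unique : ∀ {i} → toℕ i ≡ 0 → i ≡ o
  hub-unique p = Finₚ.toℕ-injective (trans p (sym toℕ-o))

  to-hub : ∀ i → Reach A (height (lv i)) i o
  to-hub i = go (lv i) refl (levelView (toℕ i))
    where
    go : ∀ s → lv i ≡ s → LevelView (toℕ i) s → Reach A (height s) i o
    go hub _  (at-hub p) = subst (λ j → Reach A 0 j o) (sym (hub-unique p)) (reach-refl A o)
    go mid eq _ = reach-adj (adj-sym′ o i (adj-hub i eq))
    go tip eq _ = let p , h = attach i eq in
      reach-step {z = p} (adj-sym′ p i (hang-adj p i h)) (reach-adj (adj-sym′ o p (adj-hub p (proj₁ (hang-levels p i h)))))

  from-hub : ∀ i → Reach A (height (lv i)) o i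
  from-hub i = go (lv i) refl (levelView (toℕ i))
    where
    go : ∀ s → lv i ≡ s → LevelView (toℕ i) s → Reach A (height s) o i
    go hub _  (at-hub p) = subst (Reach A 0 o) (sym (hub-unique p)) (reach-refl A o)
    go mid eq _ = reach-adj (adj-hub i eq)
    go tip eq _ = let p , h = attach i eq in
      reach-step {z = p} (adj-hub p (proj₁ (hang-levels p i h))) (reach-adj (hang-adj p i h))

  -- A tip and the mid that carries it are at distance 1, while the walk through the hub has length
  -- 3; the gain is 24 - 8 = 16.
  full : Fin N → Fin N → ℕ
  full i j = base (lv i) (lv j) + 16 * (bit (hang i j) + bit (hang j i))

  weightOf : ∀ {i j : Fin N} → Dec (i ≡ j) → ℕ
  weightOf (yes _)        = 0
  weightOf {i} {j} (no _) = full i j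

  spurWeight : Fin N → Fin N → ℕ
  spurWeight i j = weightOf (i ≟ j)

  full-sym : ∀ i j → full i j ≡ full j i
  full-sym i j = cong₂ (λ s t → s + 16 * t) (base-sym (lv i) (lv j)) (+-comm (bit (hang i j)) (bit (hang j i)))

  spurWeight-diag : ∀ i → spurWeight i i ≡ 0
  spurWeight-diag i = go (i ≟ i)
    where
    go : (d : Dec (i ≡ i)) → weightOf d ≡ 0
    go (yes _) = refl
    go (no ne) = contradiction refl ne

  spurWeight-sym : ∀ i j → spurWeight i j ≡ spurWeight j i
  spurWeight-sym i j = go (i ≟ j) (j ≟ i)
    where
    go : (d : Dec (i ≡ j)) (e : Dec (j ≡ i)) → weightOf d ≡ weightOf e
    go (yes _) (yes _) = refl
    go (yes p) (no q)  = contradiction (sym p) q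
    go (no p)  (yes q) = contradiction (sym q) p
    go (no _)  (no _)  = full-sym i j

  full-split : ∀ i j → full i j ≤ spurWeight i j + δ i j * (12 * isMid (lv j) + 6 * isTip (lv j))
  full-split i j = go (i ≟ j)
    where
    go : (d : Dec (i ≡ j)) → full i j ≤ weightOf d + δ i j * (12 * isMid (lv j) + 6 * isTip (lv j))
    go (no _) = m≤m+n _ _
    go (yes refl) = ≤-reflexive (trans (cong₂ (λ s t → s + 16 * (bit t + bit t)) (diagonal (lv i)) no-loop)
      (trans (+-identityʳ _) (sym (trans (cong (_* (12 * isMid (lv i) + 6 * isTip (lv i))) (δ-refl i)) (+-identityʳ _)))))
      where
      diagonal : ∀ s → base s s ≡ 12 * isMid s + 6 * isTip s
      diagonal hub = refl
      diagonal mid = refl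
      diagonal tip = refl
      no-loop : hang i i ≡ false
      no-loop = Boolₚ.¬-not λ h → contradiction (trans (sym (proj₁ (hang-levels i i h))) (proj₂ (hang-levels i i h))) λ ()

  hang-count : k ≤ ∑∑ (λ i j → bit (hang i j))
  hang-count = begin
    k                                      ≡⟨ tips ⟨
    sum (λ j → isTip (lv j))               ≤⟨ sum-mono (λ j → pt j (lv j) refl) ⟩
    ∑∑ (λ j i → bit (hang i j))            ≡⟨ ∑∑-flip (λ i j → bit (hang i j)) ⟩
    ∑∑ (λ i j → bit (hang i j))            ∎
    where
    open ≤-Reasoning
    pt : ∀ j s → lv j ≡ s → isTip s ≤ sum (λ i → bit (hang i j))
    pt j hub _  = z≤n
    pt j mid _  = z≤n
    pt j tip eq = let i , h = attach j eq in
      ≤-trans (≤-reflexive (cong bit (sym h))) (f≤sum (λ i → bit (hang i j)) i)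

  open LevelSums lv hubs mids tips hang hang-count spurWeight full-split

  module _ (G : Graph N) (connected : Connected G) (G≅A : G ≅ A) where
    open Distance G connected

    private
      f = proj₁ G≅A
      f-bijective = proj₁ (proj₂ G≅A)

    weight≤inv : ∀ x y → spurWeight (f x) (f y) /24 ℚ.≤ inv (dist G x y)
    weight≤inv x y = go (f x ≟ f y)
      where
      hop : ∀ {s} → Reach A s (f x) (f y) → dist G x y ≤ s
      hop R = dist-min x y (reach-≅ G≅A R)
      route : dist G x y ≤ height (lv (f x)) + height (lv (f y))
      route = hop (reach-trans (to-hub (f x)) (from-hub (f y)))
      go : (d : Dec (f x ≡ f y)) → weightOf d /24 ℚ.≤ inv (dist G x y)
      go (yes eq) = ℚₚ.≤-reflexive (cong inv (sym (trans (cong (dist G x) (sym (proj₁ f-bijective eq))) (dist-refl x))))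
      go (no ne) = by-hang (hang (f x) (f y) Boolₚ.≟ true) (hang (f y) (f x) Boolₚ.≟ true)
        where
        1≤d : 1 ≤ dist G x y
        1≤d = ≤∧≢⇒< z≤n λ eq → ne (cong f (dist≡0⇒≡ x y (sym eq)))
        one : ∀ {w} → w ≡ 24 → dist G x y ≤ 1 → w /24 ℚ.≤ inv (dist G x y)
        one refl le = inv≥ {dist G x y} {24} 1 1≤d le refl
        through : ∀ s t → LevelView (toℕ (f x)) s → LevelView (toℕ (f y)) t → dist G x y ≤ height s + height t → base s t /24 ℚ.≤ inv (dist G x y)
        through hub hub (at-hub p) (at-hub q) _ = contradiction (Finₚ.toℕ-injective (trans p (sym q))) ne
        through hub mid _ _ le = inv≥ {dist G x y} {24} 1 1≤d le refl
        through hub tip _ _ le = inv≥ {dist G x y} {12} 2 1≤d le refl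
        through mid hub _ _ le = inv≥ {dist G x y} {24} 1 1≤d le refl
        through mid mid _ _ le = inv≥ {dist G x y} {12} 2 1≤d le refl
        through mid tip _ _ le = inv≥ {dist G x y} {8} 3 1≤d le refl
        through tip hub _ _ le = inv≥ {dist G x y} {12} 2 1≤d le refl
        through tip mid _ _ le = inv≥ {dist G x y} {8} 3 1≤d le refl
        through tip tip _ _ le = inv≥ {dist G x y} {6} 4 1≤d le refl
        exclusive : ∀ i j → hang i j ≡ true → hang j i ≢ true
        exclusive i j h h′ = contradiction (trans (sym (proj₁ (hang-levels i j h))) (proj₂ (hang-levels j i h′))) λ ()
        by-hang : Dec (hang (f x) (f y) ≡ true) → Dec (hang (f y) (f x) ≡ true) → full (f x) (f y) /24 ℚ.≤ inv (dist G x y)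
        by-hang (yes h) _ = one (cong₂ (λ s t → s + 16 * t) (cong₂ base (proj₁ (hang-levels (f x) (f y) h)) (proj₂ (hang-levels (f x) (f y) h)))
          (cong₂ (λ b c → bit b + bit c) h (Boolₚ.¬-not (exclusive (f x) (f y) h)))) (hop (reach-adj (hang-adj (f x) (f y) h)))
        by-hang (no ¬h) (yes h) = one (cong₂ (λ s t → s + 16 * t) (cong₂ base (proj₂ (hang-levels (f y) (f x) h)) (proj₁ (hang-levels (f y) (f x) h)))
          (cong₂ (λ b c → bit b + bit c) (Boolₚ.¬-not ¬h) h)) (hop (reach-adj (adj-sym′ (f y) (f x) (hang-adj (f y) (f x) h))))
        by-hang (no ¬h) (no ¬h′) = subst (λ w → w /24 ℚ.≤ inv (dist G x y))
          (sym (trans (cong₂ (λ b c → base (lv (f x)) (lv (f y)) + 16 * (bit b + bit c)) (Boolₚ.¬-not ¬h) (Boolₚ.¬-not ¬h′)) (+-identityʳ _)))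
          (through (lv (f x)) (lv (f y)) (levelView (toℕ (f x))) (levelView (toℕ (f y))) route)

    -- A lower bound is enough, as the upper bound holds for every tree. The surplus
    -- `12 * m + 6 * k` of the diagonal stands on both sides and cancels.
    spur-harary : ∃ λ S → S /24 ℚ.≤ harary G ×
      6 * N * N + suc k * suc k + 9 * suc k + 10 * N ≤ S + (4 * suc k * N + 22)
    spur-harary = ∑< w , harary-≥ G w weight≤inv , *-cancelˡ-≤ 2 (+-cancelʳ-≤ (12 * m + 6 * k) _ _ (begin
      2 * (6 * N * N + suc k * suc k + 9 * suc k + 10 * N) + (12 * m + 6 * k) ≡⟨ identity N≡ ⟩
      24 * (1 * m + m * 1) + (12 * (1 * k + k * 1 + m * m) + (8 * (m * k + k * m) + 6 * (k * k))) + 16 * (k + k) + 2 * (4 * suc k * N + 22)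
        ≤⟨ +-monoˡ-≤ (2 * (4 * suc k * N + 22)) weight-sum ⟩
      ∑∑ spurWeight + (12 * m + 6 * k) + 2 * (4 * suc k * N + 22)
        ≡⟨ cong (λ s → s + (12 * m + 6 * k) + 2 * (4 * suc k * N + 22)) (trans (sym (∑∑-bijection spurWeight f-bijective))
             (∑∑≡2∑< w (λ x y → spurWeight-sym (f x) (f y)) (λ x → spurWeight-diag (f x)))) ⟩
      2 * ∑< w + (12 * m + 6 * k) + 2 * (4 * suc k * N + 22)  ≡⟨ regroup (∑< w) (12 * m + 6 * k) (4 * suc k * N + 22) ⟩
      2 * (∑< w + (4 * suc k * N + 22)) + (12 * m + 6 * k) ∎))
      where
      open ≤-Reasoning
      w : Fin N → Fin N → ℕ
      w x y = spurWeight (f x) (f y)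
      regroup : ∀ s t u → 2 * s + t + 2 * u ≡ 2 * (s + u) + t
      regroup = solve-∀
      poly : ∀ m k → 2 * (6 * (1 + (m + k)) * (1 + (m + k)) + (1 + k) * (1 + k) + 9 * (1 + k) + 10 * (1 + (m + k))) + (12 * m + 6 * k)
        ≡ 24 * (1 * m + m * 1) + (12 * (1 * k + k * 1 + m * m) + (8 * (m * k + k * m) + 6 * (k * k))) + 16 * (k + k) + 2 * (4 * (1 + k) * (1 + (m + k)) + 22)
      poly = solve-∀
      identity : ∀ {N} → N ≡ suc (m + k) → 2 * (6 * N * N + suc k * suc k + 9 * suc k + 10 * N) + (12 * m + 6 * k)
        ≡ 24 * (1 * m + m * 1) + (12 * (1 * k + k * 1 + m * m) + (8 * (m * k + k * m) + 6 * (k * k))) + 16 * (k + k) + 2 * (4 * suc k * N + 22)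
      identity refl = poly m k

-- Size constraints on n and β, and the two directions of the equality case

neighbour : (G : Graph n) → Connected G → ∀ {x y} → x ≢ y → ∃ λ z → Adj G x z
neighbour G connected {x} {y} x≢y = go (dist G x y) refl
  where
  open Distance G connected
  go : ∀ d → dist G x y ≡ d → ∃ λ z → Adj G x z
  go zero    eq = contradiction (dist≡0⇒≡ x y eq) x≢y
  go (suc d) eq = let z , xz , _ = dist-descend x y eq in z , xz

distinct-vertices : 2 ≤ n → ∃ λ (x : Fin n) → ∃ λ y → x ≢ y
distinct-vertices (s≤s (s≤s _)) = zero , suc zero , λ ()

module _ {G : Graph n} {β : ℕ} (M : Mating G β) where
  open Mating M

  matched-vertex : 1 ≤ β → ∃ λ r → mate r ≢ r
  matched-vertex 1≤β with Finₚ.any? (λ x → ¬? (mate x ≟ x))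
  ... | yes found = found
  ... | no none   = contradiction (*-cancelˡ-≡ β 0 2 (trans (sym moved-sum) (trans
      (sum-cong-≗ {n} (λ x → moved-≡ mate (fixed x))) (trans (sum-const n 0) (*-zeroʳ n))))) (≢-sym (<⇒≢ 1≤β))
    where
    fixed : ∀ x → mate x ≡ x
    fixed x with mate x ≟ x
    ... | yes eq = eq
    ... | no ne  = contradiction (x , ne) none

  2β≤n : 2 * β ≤ n
  2β≤n = ≤-trans (≤-reflexive (sym moved-sum)) (≤-trans (sum-mono pt) (≤-reflexive (trans (sum-const n 1) (*-identityʳ n))))
    where
    pt : ∀ x → moved mate x ≤ 1
    pt x with does (mate x ≟ x)
    ... | true  = z≤n
    ... | false = ≤-refl

-- With β = k + 1, the inequality 2β ≤ n leaves the hub at least as many neighbours as there are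
-- tips to be carried.
spur-size : ∀ n k → 2 * suc k ≤ n → k ≤ n ∸ suc k × n ≡ suc ((n ∸ suc k) + k)
spur-size n k 2β≤n = m+n≤o⇒m≤o∸n k (≤-trans (+-monoˡ-≤ (suc k) (n≤1+n k)) β+β≤n) ,
  trans (sym (m∸n+n≡m β≤n)) (+-suc (n ∸ suc k) k)
  where
  β+β≤n : suc k + suc k ≤ n
  β+β≤n = subst (_≤ n) (cong (suc k +_) (+-identityʳ (suc k))) 2β≤n
  β≤n : suc k ≤ n
  β≤n = ≤-trans (m≤m+n (suc k) (suc k)) β+β≤n

spur-attains : ∀ {β} (G : Graph n) → Connected G → Mating G β → 1 ≤ β → ∀ {B} →
  B + (4 * β * n + 22) ≡ 6 * n * n + β * β + 9 * β + 10 * n → G ≅ spur n (n ∸ β) → B /24 ℚ.≤ harary G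
spur-attains {n} {suc k} G connected M _ {B} B≡ G≅A =
  ℚₚ.≤-trans (/24-mono {B} {proj₁ lower} (+-cancelʳ-≤ (4 * suc k * n + 22) B (proj₁ lower) (≤-trans (≤-reflexive B≡) (proj₂ (proj₂ lower)))))
    (proj₁ (proj₂ lower))
  where
  size = spur-size n k (2β≤n M)
  lower = SpurWeight.spur-harary (n ∸ suc k) k n (proj₁ size) (proj₂ size) G connected G≅A

theorem3p4 : (n : ℕ) (T : Graph n) (β : ℕ) → 2 ≤ n → IsTree T → IsMatchingNumber T β →
    (harary T ℚ.≤ bound n β) × ((harary T ≡ bound n β) ⇔ (T ≅ spur n (n ∸ β)))
theorem3p4 n T β 2≤n tree@(simple , connected , _) max = upper , mk⇔ attained⇒spur spur⇒attained
  where
  M : Mating T β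
  M = maximum T simple max
  1≤β : 1 ≤ β
  1≤β = edge⇒1≤β T simple max (proj₂ (neighbour T connected (proj₂ (proj₂ (distinct-vertices 2≤n)))))
  -- With a matched root, every unmatched vertex has a proper parent and the correction in `Z-value`
  -- is 44.
  root = matched-vertex M 1≤β
  r = proj₁ root
  open Weight T tree r using (weight; inv-dist≤weight)
  open Counting T tree r M (unmatched-independent T simple max) (proj₂ root) using (S; X; Y; weight-bound)
  B : ℕ
  B = X ∸ Y
  B+Y≡X : B + Y ≡ X
  -- The truncated difference is exact, since Y ≤ S + Y ≤ X.
  B+Y≡X = m∸n+n≡m (≤-trans (m≤n+m Y S) weight-bound)
  bound≡B : bound n β ≡ B /24
  bound≡B = bound≡ n β B B+Y≡X
  harary≤S : harary T ℚ.≤ S /24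
  harary≤S = harary-≤ T weight inv-dist≤weight
  upper : harary T ℚ.≤ bound n β
  upper = subst (harary T ℚ.≤_) (sym bound≡B)
    (ℚₚ.≤-trans harary≤S (/24-mono {S} {B} (+-cancelʳ-≤ Y S B (≤-trans weight-bound (≤-reflexive (sym B+Y≡X))))))
  attained⇒spur : harary T ≡ bound n β → T ≅ spur n (n ∸ β)
  -- As S / 24 dominates the Harary index, attaining B / 24 gives B ≤ S, that is X ≤ S + Y, the
  -- hypothesis of `Tight`.
  attained⇒spur eq = SpurIso.iso T tree M
    (Extremal.spurlike T tree r M (unmatched-independent T simple max) (proj₂ root)
      (≤-trans (≤-reflexive (sym B+Y≡X)) (+-monoˡ-≤ Y (/24-cancel {B} {S} (subst (ℚ._≤ S /24) (trans eq bound≡B) harary≤S)))))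
  spur⇒attained : T ≅ spur n (n ∸ β) → harary T ≡ bound n β
  spur⇒attained T≅A = ℚₚ.≤-antisym upper
    (subst (ℚ._≤ harary T) (sym bound≡B) (spur-attains T connected M 1≤β {B} B+Y≡X T≅A))
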